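{- Let $r\ge 1$ be an integer and suppose that $A\subseteq\mathbb{F}_2^r$ is round. If $|A|>\frac{11}{36}\,2^r+3$, then there are a sum-free set $S\subseteq\mathbb{F}_2^r$ and an element $g\in\mathbb{F}_2^r$ such that $A=g+(S\cup\{0\})$.
   Context: $\mathbb{F}_2^r$ denotes the elementary abelian $2$-group of rank $r$. For $X\subseteq\mathbb{F}_2^r$, $2X:=\{x_1+x_2\colon x_1,x_2\in X\}$ (with $x_1=x_2$ allowed), and $g+X:=\{g+x\colon x\in X\}$. A set $A\subseteq\mathbb{F}_2^r$ is round if $2B\ne 2A$ for every proper subset $B\subsetneq A$. A set $S$ is sum-free if $S\cap 2S=\varnothing$. -}

module Defs where

open import Data.Bool using (Bool; true; false; _xor_)
open import Data.Nat using (ℕ; zero; suc)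
open import Data.Vec using (Vec; []; _∷_; zipWith; replicate)
open import Data.List using (List; []; _∷_; map; _++_; length; filter)
open import Data.Product using (Σ; ∃; _×_; _,_)
open import Data.Sum using (_⊎_)
open import Relation.Binary.PropositionalEquality using (_≡_)
open import Relation.Nullary using (¬_)
open import Function.Bundles using (_⇔_)
open import Data.Bool.Properties using (T?)

V : ℕ → Set
V r = Vec Bool r

_⊕_ : ∀ {r} → V r → V r → V r
_⊕_ = zipWith _xor_

𝟎 : ∀ {r} → V r
𝟎 = replicate _ false

Subset₂ : ℕ → Set
Subset₂ r = V r → Bool

_∈ₛ_ : ∀ {r} → V r → Subset₂ r → Set
x ∈ₛ X = X x ≡ true

_≐_ : ∀ {r} → Subset₂ r → Subset₂ r → Set
X ≐ Y = ∀ x → (x ∈ₛ X) ⇔ (x ∈ₛ Y)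

_∈2_ : ∀ {r} → V r → Subset₂ r → Set
x ∈2 X = ∃ λ x₁ → ∃ λ x₂ → x₁ ∈ₛ X × x₂ ∈ₛ X × x ≡ x₁ ⊕ x₂

SameDoubling : ∀ {r} → Subset₂ r → Subset₂ r → Set
SameDoubling B A = ∀ x → (x ∈2 B) ⇔ (x ∈2 A)

ProperSubset : ∀ {r} → Subset₂ r → Subset₂ r → Set
ProperSubset B A = (∀ x → x ∈ₛ B → x ∈ₛ A) × (∃ λ x → x ∈ₛ A × ¬ (x ∈ₛ B))

Round : ∀ {r} → Subset₂ r → Set
Round A = ∀ B → ProperSubset B A → ¬ SameDoubling B A

SumFree : ∀ {r} → Subset₂ r → Set
SumFree S = ∀ x → ¬ (x ∈ₛ S × x ∈2 S)

allV : (r : ℕ) → List (V r)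
allV zero = [] ∷ []
allV (suc r) = map (false ∷_) (allV r) ++ map (true ∷_) (allV r)

card : ∀ {r} → Subset₂ r → ℕ
card {r} X = length (filter (λ x → T? (X x)) (allV r))

IsTranslateOfSZero : ∀ {r} → Subset₂ r → V r → Subset₂ r → Set
IsTranslateOfSZero A g S =
  ∀ x → (x ∈ₛ A) ⇔ (∃ λ y → (y ∈ₛ S ⊎ y ≡ 𝟎) × x ≡ g ⊕ y)

{-# OPTIONS --safe #-}

-- Let N = 2 ^ r = 2 M and n = |A|, and let U be the set of those u that have exactly one unordered
-- representation u = a + b with a, b in A; join a and b by an edge when a + b lies in U.  Roundness
-- means that this graph has no isolated vertex, and the theorem says that it is a star: if g is
-- adjacent to every other vertex, then S = (g + A) \ {0} is sum-free.
--
-- For an edge {x , x + u}, the sets A + x and A + x + u are almost disjoint, and both avoid every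
-- unique sum that involves neither x nor x + u.  As n is large, this makes U sum-free, and it gives
-- |U| + n <= M + deg x + deg (x + u).  Take a maximal matching; let it have k edges and put
-- tau = |U| + n - M.
--
-- If tau >= 3, then double counting of degrees leaves k <= 2, so two vertices of large degree meet
-- every edge, and two stars that together cover A are excluded by packing translates of A.
--
-- If tau <= 2, then many matching edges u have ends of small degree.  For z = u + v with v in U,
-- the disjointness above yields rep z >= 2 n - M - 8 + rep_U z, where rep and rep_U count
-- representations by A and by U.  On the other hand, at most one end of each matching edge stays
-- in A when moved by z, which bounds rep z from above.  Summing over z gives a contradiction.

module Submission where

open import Defs
open import Data.Bool using (Bool; true; false; _∧_; _∨_; not; T)
open import Data.Bool.Properties using (T?; xor-assoc; xor-comm; xor-identityˡ; xor-same; ∨-identityʳ)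
open import Data.Empty using (⊥; ⊥-elim)
open import Data.Fin using (Fin; zero; suc)
open import Data.List using (List; []; _∷_; _++_; length; filter; map)
open import Data.List.Properties using (filter-++; length-++)
open import Data.Nat using (ℕ; zero; suc; _+_; _*_; _∸_; _^_; _≤_; _<_; z≤n; s≤s; _≡ᵇ_; _≤ᵇ_; _≤?_)
open import Data.Nat.Properties
open import Data.Nat.Tactic.RingSolver using (solve-∀)
open import Data.Product using (∃; _×_; _,_; proj₁; proj₂)
open import Data.Sum using (_⊎_; inj₁; inj₂)
open import Data.Unit using (tt)
open import Data.Vec using (Vec; []; _∷_; lookup)
import Data.Bool as Bool
import Data.Vec.Properties as Vec
open import Function using (_∘_; case_of_)
open import Function.Bundles using (mk⇔)
open import Relation.Binary.PropositionalEquality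
open import Relation.Nullary using (Dec; yes; no; does)

-- The group 𝔽₂ʳ

-- Everything rests on the quotient by an edge sum `u`. It has `M` elements, and `A + x` maps into
-- it injectively except that `x` and `x ⊕ u` collide, because `u` has no other representation. The
-- image thus fills `n - 1` classes, more than half of them, so it meets its shift by any `z` in at
-- least `2 n - 2 - M` classes, and the size of this overlap is controlled by `rep z + rep (z ⊕ u)`.
-- If `z` is a unique sum, then `rep (z ⊕ u)` must be large. The split at tau = 3 comes from degree
-- sums: every edge has degree sum at least tau, whereas the absence of isolated vertices alone
-- gives 2. For tau at most 2 nothing about the shape of the graph follows, and only a count over
-- all `z` is left. That count ends in an inequality quadratic in the matching parameters, whose
-- constants fail for small `M`; there it is rescued by `M` being a power of two and `n` an integer.

⊕-comm : ∀ {r} (x y : V r) → x ⊕ y ≡ y ⊕ x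
⊕-comm = Vec.zipWith-comm xor-comm

⊕-assoc : ∀ {r} (x y z : V r) → (x ⊕ y) ⊕ z ≡ x ⊕ (y ⊕ z)
⊕-assoc = Vec.zipWith-assoc xor-assoc

⊕-identityˡ : ∀ {r} (x : V r) → 𝟎 ⊕ x ≡ x
⊕-identityˡ = Vec.zipWith-identityˡ xor-identityˡ

⊕-identityʳ : ∀ {r} (x : V r) → x ⊕ 𝟎 ≡ x
⊕-identityʳ x = trans (⊕-comm x 𝟎) (⊕-identityˡ x)

⊕-self : ∀ {r} (x : V r) → x ⊕ x ≡ 𝟎
⊕-self [] = refl
⊕-self (b ∷ x) = cong₂ _∷_ (xor-same b) (⊕-self x)

⊕-interchange : ∀ {r} (x y z w : V r) → (x ⊕ y) ⊕ (z ⊕ w) ≡ (x ⊕ z) ⊕ (y ⊕ w)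
⊕-interchange x y z w = begin
  (x ⊕ y) ⊕ (z ⊕ w)  ≡⟨ ⊕-assoc x y (z ⊕ w) ⟩
  x ⊕ (y ⊕ (z ⊕ w))  ≡⟨ cong (x ⊕_) (sym (⊕-assoc y z w)) ⟩
  x ⊕ ((y ⊕ z) ⊕ w)  ≡⟨ cong (λ t → x ⊕ (t ⊕ w)) (⊕-comm y z) ⟩
  x ⊕ ((z ⊕ y) ⊕ w)  ≡⟨ cong (x ⊕_) (⊕-assoc z y w) ⟩
  x ⊕ (z ⊕ (y ⊕ w))  ≡⟨ sym (⊕-assoc x z (y ⊕ w)) ⟩
  (x ⊕ z) ⊕ (y ⊕ w)  ∎
  where open ≡-Reasoning

-- Linear identities over 𝔽₂ by comparison of coefficients

infixl 6 _⊞_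

data Expr (n : ℕ) : Set where
  var : Fin n → Expr n
  nil : Expr n
  _⊞_ : Expr n → Expr n → Expr n

eval : ∀ {n r} → Expr n → Vec (V r) n → V r
eval (var i) ρ = lookup ρ i
eval nil     ρ = 𝟎
eval (e ⊞ f) ρ = eval e ρ ⊕ eval f ρ

unit : ∀ {n} → Fin n → V n
unit zero    = true ∷ 𝟎
unit (suc i) = false ∷ unit i

coefficients : ∀ {n} → Expr n → V n
coefficients (var i) = unit i
coefficients nil     = 𝟎
coefficients (e ⊞ f) = coefficients e ⊕ coefficients f

combination : ∀ {n r} → V n → Vec (V r) n → V r
combination []          []      = 𝟎
combination (true ∷ c)  (x ∷ ρ) = x ⊕ combination c ρ
combination (false ∷ c) (x ∷ ρ) = combination c ρ

combination-𝟎 : ∀ {n r} (ρ : Vec (V r) n) → combination 𝟎 ρ ≡ 𝟎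
combination-𝟎 []      = refl
combination-𝟎 (x ∷ ρ) = combination-𝟎 ρ

combination-unit : ∀ {n r} (i : Fin n) (ρ : Vec (V r) n) → combination (unit i) ρ ≡ lookup ρ i
combination-unit zero    (x ∷ ρ) = trans (cong (x ⊕_) (combination-𝟎 ρ)) (⊕-identityʳ x)
combination-unit (suc i) (x ∷ ρ) = combination-unit i ρ

combination-⊕ : ∀ {n r} (c d : V n) (ρ : Vec (V r) n) →
                combination (c ⊕ d) ρ ≡ combination c ρ ⊕ combination d ρ
combination-⊕ [] [] [] = sym (⊕-identityˡ 𝟎)
combination-⊕ (true ∷ c) (true ∷ d) (x ∷ ρ) = begin
  combination (c ⊕ d) ρ                              ≡⟨ combination-⊕ c d ρ ⟩
  combination c ρ ⊕ combination d ρ                  ≡⟨ sym (⊕-identityˡ _) ⟩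
  𝟎 ⊕ (combination c ρ ⊕ combination d ρ)            ≡⟨ cong (_⊕ _) (sym (⊕-self x)) ⟩
  (x ⊕ x) ⊕ (combination c ρ ⊕ combination d ρ)      ≡⟨ ⊕-interchange x x _ _ ⟩
  (x ⊕ combination c ρ) ⊕ (x ⊕ combination d ρ)      ∎
  where open ≡-Reasoning
combination-⊕ (true ∷ c) (false ∷ d) (x ∷ ρ) =
  trans (cong (x ⊕_) (combination-⊕ c d ρ)) (sym (⊕-assoc x _ _))
combination-⊕ (false ∷ c) (true ∷ d) (x ∷ ρ) = begin
  x ⊕ combination (c ⊕ d) ρ                 ≡⟨ cong (x ⊕_) (combination-⊕ c d ρ) ⟩
  x ⊕ (combination c ρ ⊕ combination d ρ)   ≡⟨ sym (⊕-assoc x _ _) ⟩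
  (x ⊕ combination c ρ) ⊕ combination d ρ   ≡⟨ cong (_⊕ combination d ρ) (⊕-comm x _) ⟩
  (combination c ρ ⊕ x) ⊕ combination d ρ   ≡⟨ ⊕-assoc _ x _ ⟩
  combination c ρ ⊕ (x ⊕ combination d ρ)   ∎
  where open ≡-Reasoning
combination-⊕ (false ∷ c) (false ∷ d) (x ∷ ρ) = combination-⊕ c d ρ

eval-combination : ∀ {n r} (e : Expr n) (ρ : Vec (V r) n) → eval e ρ ≡ combination (coefficients e) ρ
eval-combination (var i) ρ = sym (combination-unit i ρ)
eval-combination nil     ρ = sym (combination-𝟎 ρ)
eval-combination (e ⊞ f) ρ =
  trans (cong₂ _⊕_ (eval-combination e ρ) (eval-combination f ρ))
        (sym (combination-⊕ (coefficients e) (coefficients f) ρ))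

-- Both sides equal the linear combination given by their coefficient vectors. For a concrete
-- identity these vectors are closed terms, so the hypothesis is always `refl`.
xor-solve : ∀ {n r} (ρ : Vec (V r) n) (e f : Expr n) → coefficients e ≡ coefficients f → eval e ρ ≡ eval f ρ
xor-solve ρ e f p =
  trans (eval-combination e ρ) (trans (cong (λ c → combination c ρ) p) (sym (eval-combination f ρ)))

x₀ : ∀ {n} → Expr (suc n)
x₀ = var zero
x₁ : ∀ {n} → Expr (suc (suc n))
x₁ = var (suc zero)
x₂ : ∀ {n} → Expr (suc (suc (suc n)))
x₂ = var (suc (suc zero))
x₃ : ∀ {n} → Expr (suc (suc (suc (suc n))))
x₃ = var (suc (suc (suc zero)))
x₄ : ∀ {n} → Expr (suc (suc (suc (suc (suc n)))))
x₄ = var (suc (suc (suc (suc zero))))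
x₅ : ∀ {n} → Expr (suc (suc (suc (suc (suc (suc n))))))
x₅ = var (suc (suc (suc (suc (suc zero)))))

⊕-cancelʳ : ∀ {r} (x y : V r) → (x ⊕ y) ⊕ y ≡ x
⊕-cancelʳ x y = xor-solve (x ∷ y ∷ []) ((x₀ ⊞ x₁) ⊞ x₁) x₀ refl

⊕≡𝟎⇒≡ : ∀ {r} {x y : V r} → x ⊕ y ≡ 𝟎 → x ≡ y
⊕≡𝟎⇒≡ {x = x} {y} p = trans (sym (⊕-cancelʳ x y)) (trans (cong (_⊕ y) p) (⊕-identityˡ y))

_≟ⱽ_ : ∀ {r} (x y : V r) → Dec (x ≡ y)
_≟ⱽ_ = Vec.≡-dec Bool._≟_

-- Sums over 𝔽₂ʳ

abstract

  -- Opaque, so that goals keep the shape `∑ f` and unification compares summands; `∑-suc` and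
  -- `∑-zero` export the defining equations.
  ∑ : ∀ {r} → (V r → ℕ) → ℕ
  ∑ {zero}  f = f []
  ∑ {suc r} f = ∑ (λ x → f (false ∷ x)) + ∑ (λ x → f (true ∷ x))

  ∑-suc : ∀ {r} (f : V (suc r) → ℕ) → ∑ f ≡ ∑ (λ x → f (false ∷ x)) + ∑ (λ x → f (true ∷ x))
  ∑-suc f = refl

  ∑-zero : (f : V zero → ℕ) → ∑ f ≡ f []
  ∑-zero f = refl

  ∑-cong : ∀ {r} {f g : V r → ℕ} → (∀ x → f x ≡ g x) → ∑ f ≡ ∑ g
  ∑-cong {zero}  p = p []
  ∑-cong {suc r} p = cong₂ _+_ (∑-cong (λ x → p (false ∷ x))) (∑-cong (λ x → p (true ∷ x)))

  ∑-mono : ∀ {r} {f g : V r → ℕ} → (∀ x → f x ≤ g x) → ∑ f ≤ ∑ g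
  ∑-mono {zero}  p = p []
  ∑-mono {suc r} p = +-mono-≤ (∑-mono (λ x → p (false ∷ x))) (∑-mono (λ x → p (true ∷ x)))

  ∑-+ : ∀ {r} (f g : V r → ℕ) → ∑ (λ x → f x + g x) ≡ ∑ f + ∑ g
  ∑-+ {zero}  f g = refl
  ∑-+ {suc r} f g =
    trans (cong₂ _+_ (∑-+ (f ∘ (false ∷_)) (g ∘ (false ∷_))) (∑-+ (f ∘ (true ∷_)) (g ∘ (true ∷_))))
          (+-interchange (∑ (f ∘ (false ∷_))) _ _ _)
    where
    +-interchange : ∀ a b c d → (a + b) + (c + d) ≡ (a + c) + (b + d)
    +-interchange = solve-∀

  ∑-*ˡ : ∀ {r} c (f : V r → ℕ) → ∑ (λ x → c * f x) ≡ c * ∑ f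
  ∑-*ˡ {zero}  c f = refl
  ∑-*ˡ {suc r} c f =
    trans (cong₂ _+_ (∑-*ˡ c (f ∘ (false ∷_))) (∑-*ˡ c (f ∘ (true ∷_)))) (sym (*-distribˡ-+ c _ _))

  ∑-const : ∀ r c → ∑ {r} (λ _ → c) ≡ 2 ^ r * c
  ∑-const zero    c = sym (*-identityˡ c)
  ∑-const (suc r) c = trans (cong₂ _+_ (∑-const r c) (∑-const r c)) (double (2 ^ r) c)
    where
    double : ∀ a c → a * c + a * c ≡ 2 * a * c
    double = solve-∀

  ∑-swap : ∀ {r s} (f : V r → V s → ℕ) → ∑ (λ x → ∑ (λ y → f x y)) ≡ ∑ (λ y → ∑ (λ x → f x y))
  ∑-swap {zero}  f = refl
  ∑-swap {suc r} f =
    trans (cong₂ _+_ (∑-swap (λ x → f (false ∷ x))) (∑-swap (λ x → f (true ∷ x))))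
          (sym (∑-+ (λ y → ∑ (λ x → f (false ∷ x) y)) (λ y → ∑ (λ x → f (true ∷ x) y))))

  ∑-shift : ∀ {r} (f : V r → ℕ) y → ∑ (λ x → f (x ⊕ y)) ≡ ∑ f
  ∑-shift {zero}  f []          = refl
  ∑-shift {suc r} f (false ∷ y) = cong₂ _+_ (∑-shift (f ∘ (false ∷_)) y) (∑-shift (f ∘ (true ∷_)) y)
  ∑-shift {suc r} f (true ∷ y)  =
    trans (cong₂ _+_ (∑-shift (f ∘ (true ∷_)) y) (∑-shift (f ∘ (false ∷_)) y)) (+-comm (∑ (f ∘ (true ∷_))) _)

  term≤∑ : ∀ {r} (f : V r → ℕ) x → f x ≤ ∑ f
  term≤∑ {zero}  f []          = ≤-refl
  term≤∑ {suc r} f (false ∷ x) = ≤-trans (term≤∑ (f ∘ (false ∷_)) x) (m≤m+n _ _)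
  term≤∑ {suc r} f (true ∷ x)  = ≤-trans (term≤∑ (f ∘ (true ∷_)) x) (m≤n+m _ _)

  ∑≢0⇒∃ : ∀ {r} (f : V r → ℕ) → ∑ f ≢ 0 → ∃ λ x → f x ≢ 0
  ∑≢0⇒∃ {zero}  f p = [] , p
  ∑≢0⇒∃ {suc r} f p with ∑ (λ x → f (false ∷ x)) ≟ 0
  ... | no q  = let (x , fx) = ∑≢0⇒∃ (f ∘ (false ∷_)) q in false ∷ x , fx
  ... | yes q = let (x , fx) = ∑≢0⇒∃ (f ∘ (true ∷_)) (λ q′ → p (cong₂ _+_ q q′)) in true ∷ x , fx

∑-*ʳ : ∀ {r} c (f : V r → ℕ) → ∑ (λ x → f x * c) ≡ ∑ f * c
∑-*ʳ c f = trans (∑-cong (λ x → *-comm (f x) c)) (trans (∑-*ˡ c f) (*-comm c _))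

∑-0 : ∀ r → ∑ {r} (λ _ → 0) ≡ 0
∑-0 r = trans (∑-const r 0) (*-zeroʳ (2 ^ r))

∑≡0⇒ : ∀ {r} (f : V r → ℕ) → ∑ f ≡ 0 → ∀ x → f x ≡ 0
∑≡0⇒ f p x = n≤0⇒n≡0 (subst (f x ≤_) p (term≤∑ f x))

-- The Kronecker delta, by recursion on bits rather than through `_≟ⱽ_`, so that it splits along
-- with `∑` in `∑-pt*`.
pt : ∀ {r} → V r → V r → ℕ
pt []          []          = 1
pt (false ∷ y) (false ∷ x) = pt y x
pt (false ∷ y) (true ∷ x)  = 0
pt (true ∷ y)  (false ∷ x) = 0
pt (true ∷ y)  (true ∷ x)  = pt y x

pt-same : ∀ {r} (y : V r) → pt y y ≡ 1
pt-same []          = refl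
pt-same (false ∷ y) = pt-same y
pt-same (true ∷ y)  = pt-same y

pt-distinct : ∀ {r} {x y : V r} → x ≢ y → pt y x ≡ 0
pt-distinct {x = []}        {[]}        p = ⊥-elim (p refl)
pt-distinct {x = false ∷ x} {false ∷ y} p = pt-distinct (λ q → p (cong (false ∷_) q))
pt-distinct {x = true ∷ x}  {false ∷ y} p = refl
pt-distinct {x = false ∷ x} {true ∷ y}  p = refl
pt-distinct {x = true ∷ x}  {true ∷ y}  p = pt-distinct (λ q → p (cong (true ∷_) q))

∑-pt* : ∀ {r} y (f : V r → ℕ) → ∑ (λ x → pt y x * f x) ≡ f y
∑-pt* []                  f = trans (∑-zero _) (*-identityˡ _)
∑-pt* {suc r} (false ∷ y) f =
  trans (∑-suc _) (trans (cong₂ _+_ (∑-pt* y (f ∘ (false ∷_))) (∑-0 r)) (+-identityʳ _))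
∑-pt* {suc r} (true ∷ y)  f = trans (∑-suc _) (cong₂ _+_ (∑-0 r) (∑-pt* y (f ∘ (true ∷_))))

∑-pt : ∀ {r} (y : V r) → ∑ (pt y) ≡ 1
∑-pt y = trans (∑-cong (λ x → sym (*-identityʳ (pt y x)))) (∑-pt* y (λ _ → 1))

-- Indicator functions

𝟙 : Bool → ℕ
𝟙 true  = 1
𝟙 false = 0

χ : ∀ {r} → Subset₂ r → V r → ℕ
χ X x = 𝟙 (X x)

𝟙≤1 : ∀ b → 𝟙 b ≤ 1
𝟙≤1 true  = ≤-refl
𝟙≤1 false = z≤n

𝟙≢0⇒ : ∀ b → 𝟙 b ≢ 0 → b ≡ true
𝟙≢0⇒ true  p = refl
𝟙≢0⇒ false p = ⊥-elim (p refl)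

card≡∑ : ∀ {r} (X : Subset₂ r) → card X ≡ ∑ (χ X)
card≡∑ {r} X = go X
  where
  count : ∀ {B : Set} → (B → Bool) → List B → ℕ
  count p xs = length (filter (λ x → T? (p x)) xs)
  count-map : ∀ {B C : Set} (p : C → Bool) (h : B → C) xs → count p (map h xs) ≡ count (p ∘ h) xs
  count-map p h [] = refl
  count-map p h (x ∷ xs) with p (h x)
  ... | true  = cong suc (count-map p h xs)
  ... | false = count-map p h xs
  go : ∀ {s} (Y : V s → Bool) → count Y (allV s) ≡ ∑ (χ Y)
  go {zero} Y rewrite ∑-zero (χ Y) with Y []
  ... | true  = refl
  ... | false = refl
  go {suc s} Y = begin
    count Y (map (false ∷_) (allV s) ++ map (true ∷_) (allV s))
      ≡⟨ cong length (filter-++ (λ x → T? (Y x)) (map (false ∷_) (allV s)) _) ⟩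
    length (filter (λ x → T? (Y x)) (map (false ∷_) (allV s)) ++ filter (λ x → T? (Y x)) (map (true ∷_) (allV s)))
      ≡⟨ length-++ (filter (λ x → T? (Y x)) (map (false ∷_) (allV s))) ⟩
    count Y (map (false ∷_) (allV s)) + count Y (map (true ∷_) (allV s))
      ≡⟨ cong₂ _+_ (count-map Y (false ∷_) (allV s)) (count-map Y (true ∷_) (allV s)) ⟩
    count (Y ∘ (false ∷_)) (allV s) + count (Y ∘ (true ∷_)) (allV s)
      ≡⟨ cong₂ _+_ (go (Y ∘ (false ∷_))) (go (Y ∘ (true ∷_))) ⟩
    ∑ (χ (Y ∘ (false ∷_))) + ∑ (χ (Y ∘ (true ∷_)))
      ≡⟨ sym (∑-suc (χ Y)) ⟩
    ∑ (χ Y) ∎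
    where open ≡-Reasoning

∧-trueˡ : ∀ {b c} → b ∧ c ≡ true → b ≡ true
∧-trueˡ {true} p = refl

∧-trueʳ : ∀ {b c} → b ∧ c ≡ true → c ≡ true
∧-trueʳ {true} p = p

χ-true : ∀ {r} (X : Subset₂ r) {x} → X x ≡ true → χ X x ≡ 1
χ-true X p = cong 𝟙 p

χ-false : ∀ {r} (X : Subset₂ r) {x} → X x ≡ false → χ X x ≡ 0
χ-false X p = cong 𝟙 p

true≢false : true ≢ false
true≢false ()

≢true⇒false : ∀ {b} → (b ≡ true → ⊥) → b ≡ false
≢true⇒false {true}  p = ⊥-elim (p refl)
≢true⇒false {false} p = refl

𝟙-∧ : ∀ b c → 𝟙 b * 𝟙 c ≤ 𝟙 (b ∧ c)
𝟙-∧ true  true  = ≤-refl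
𝟙-∧ true  false = z≤n
𝟙-∧ false c     = z≤n

true-or-false : ∀ b → b ≡ true ⊎ b ≡ false
true-or-false true  = inj₁ refl
true-or-false false = inj₂ refl

abstract

  _∖_ : ∀ {r} → Subset₂ r → V r → Subset₂ r
  (X ∖ y) x = X x ∧ not (does (x ≟ⱽ y))

  ∖-intro : ∀ {r} (X : Subset₂ r) {x y} → X x ≡ true → x ≢ y → (X ∖ y) x ≡ true
  ∖-intro X {x} {y} p q with x ≟ⱽ y
  ... | yes t = ⊥-elim (q t)
  ... | no _ rewrite p = refl

  ∖-⊆ : ∀ {r} (X : Subset₂ r) {x y} → (X ∖ y) x ≡ true → X x ≡ true
  ∖-⊆ X {x} p = ∧-trueˡ {X x} p

  ∖-≢ : ∀ {r} (X : Subset₂ r) {x y} → (X ∖ y) x ≡ true → x ≢ y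
  ∖-≢ X {x} {y} p with x ≟ⱽ y
  ... | yes _ = ⊥-elim (true≢false (sym (∧-trueʳ {X x} p)))
  ... | no q  = q

  χ≤χ∖+pt : ∀ {r} (X : Subset₂ r) y x → χ X x ≤ χ (X ∖ y) x + pt y x
  χ≤χ∖+pt X y x with x ≟ⱽ y
  ... | yes refl rewrite pt-same x = ≤-trans (𝟙≤1 (X x)) (m≤n+m 1 _)
  ... | no q with X x
  ... | true  = m≤m+n 1 _
  ... | false = z≤n

∑χ≤∑χ∖+1 : ∀ {r} (X : Subset₂ r) y → ∑ (χ X) ≤ ∑ (χ (X ∖ y)) + 1
∑χ≤∑χ∖+1 X y = ≤-trans (∑-mono (χ≤χ∖+pt X y)) (≤-reflexive (trans (∑-+ _ _) (cong (∑ (χ (X ∖ y)) +_) (∑-pt y))))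

∑χ-inhabited : ∀ {r} (X : Subset₂ r) → 1 ≤ ∑ (χ X) → ∃ λ x → X x ≡ true
∑χ-inhabited X p with ∑≢0⇒∃ (χ X) (λ q → <⇒≢ p (sym q))
... | x , q = x , 𝟙≢0⇒ (X x) q

-- Correlations

-- In characteristic 2 correlation and convolution coincide: for indicators this counts ordered
-- pairs with sum `z`. The one operation serves for representations, degrees and all later counts.
corr : ∀ {r} → (V r → ℕ) → (V r → ℕ) → V r → ℕ
corr f g z = ∑ (λ w → f w * g (w ⊕ z))

corr-𝟎 : ∀ {r} (f g : V r → ℕ) → corr f g 𝟎 ≡ ∑ (λ w → f w * g w)
corr-𝟎 f g = ∑-cong (λ w → cong (λ t → f w * g t) (⊕-identityʳ w))

∑-corr : ∀ {r} (f g : V r → ℕ) → ∑ (corr f g) ≡ ∑ f * ∑ g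
∑-corr f g = begin
  ∑ (λ z → ∑ (λ w → f w * g (w ⊕ z)))  ≡⟨ ∑-swap (λ z w → f w * g (w ⊕ z)) ⟩
  ∑ (λ w → ∑ (λ z → f w * g (w ⊕ z)))  ≡⟨ ∑-cong (λ w → ∑-*ˡ (f w) (λ z → g (w ⊕ z))) ⟩
  ∑ (λ w → f w * ∑ (λ z → g (w ⊕ z)))  ≡⟨ ∑-cong (λ w → cong (f w *_)
      (trans (∑-cong (λ z → cong g (⊕-comm w z))) (∑-shift g w))) ⟩
  ∑ (λ w → f w * ∑ g)                  ≡⟨ ∑-*ʳ (∑ g) f ⟩
  ∑ f * ∑ g                            ∎
  where open ≡-Reasoning

-- Both sides count triples with sum `𝟎`, weighted by `f`, `g` and `h`. This is the double counting
-- that turns sums over edges into sums over vertices.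
corr-swap : ∀ {r} (f g h : V r → ℕ) → ∑ (λ z → f z * corr g h z) ≡ ∑ (λ a → g a * corr f h a)
corr-swap f g h = begin
  ∑ (λ z → f z * ∑ (λ a → g a * h (a ⊕ z)))    ≡⟨ ∑-cong (λ z → sym (∑-*ˡ (f z) _)) ⟩
  ∑ (λ z → ∑ (λ a → f z * (g a * h (a ⊕ z))))  ≡⟨ ∑-swap (λ z a → f z * (g a * h (a ⊕ z))) ⟩
  ∑ (λ a → ∑ (λ z → f z * (g a * h (a ⊕ z))))  ≡⟨ ∑-cong (λ a → ∑-cong (λ z →
      trans (cong (λ t → f z * (g a * h t)) (⊕-comm a z)) (*-left-comm (f z) (g a) (h (z ⊕ a))))) ⟩
  ∑ (λ a → ∑ (λ z → g a * (f z * h (z ⊕ a))))  ≡⟨ ∑-cong (λ a → ∑-*ˡ (g a) _) ⟩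
  ∑ (λ a → g a * corr f h a)                   ∎
  where
  open ≡-Reasoning
  *-left-comm : ∀ a b c → a * (b * c) ≡ b * (a * c)
  *-left-comm = solve-∀

corr-shift : ∀ {r} (f g : V r → ℕ) x z → corr (λ w → f (w ⊕ x)) (λ w → g (w ⊕ x)) z ≡ corr f g z
corr-shift f g x z = trans
  (∑-cong (λ w → cong (λ t → f (w ⊕ x) * g t)
    (xor-solve (w ∷ z ∷ x ∷ []) ((x₀ ⊞ x₁) ⊞ x₂) ((x₀ ⊞ x₂) ⊞ x₁) refl)))
  (∑-shift (λ w → f w * g (w ⊕ z)) x)

-- Folding along `u` is the passage to the quotient by `u`: a class of sums collects the counts of
-- `z` and `z ⊕ u`, and every class of `w` is visited twice, whence the factor 2.
corr-fold : ∀ {r} (f : V r → ℕ) u z →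
  corr (λ w → f w + f (w ⊕ u)) (λ w → f w + f (w ⊕ u)) z ≡ 2 * (corr f f z + corr f f (z ⊕ u))
corr-fold f u z = begin
  ∑ (λ w → (f w + f (w ⊕ u)) * (f (w ⊕ z) + f ((w ⊕ z) ⊕ u)))
    ≡⟨ ∑-cong (λ w → trans (expand (f w) (f (w ⊕ u)) (f (w ⊕ z)) (f ((w ⊕ z) ⊕ u)))
         (cong₂ (λ s t → p w + f w * f s + (f (w ⊕ u) * f t + q w))
           (⊕-assoc w z u) (xor-solve (w ∷ z ∷ u ∷ []) (x₀ ⊞ x₁) ((x₀ ⊞ x₂) ⊞ (x₁ ⊞ x₂)) refl))) ⟩
  ∑ (λ w → p w + p′ w + (p″ w + q w))
    ≡⟨ trans (∑-+ _ _) (cong₂ _+_ (∑-+ p p′) (∑-+ p″ q)) ⟩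
  ∑ p + ∑ p′ + (∑ p″ + ∑ q)
    ≡⟨ cong₂ (λ s t → ∑ p + ∑ p′ + (s + t)) (∑-shift p′ u) (corr-shift f f u z) ⟩
  ∑ p + ∑ p′ + (∑ p′ + ∑ p)
    ≡⟨ collect (∑ p) (∑ p′) ⟩
  2 * (corr f f z + corr f f (z ⊕ u)) ∎
  where
  open ≡-Reasoning
  p p′ p″ q : _ → ℕ
  p w  = f w * f (w ⊕ z)
  p′ w = f w * f (w ⊕ (z ⊕ u))
  p″ w = f (w ⊕ u) * f ((w ⊕ u) ⊕ (z ⊕ u))
  q w  = f (w ⊕ u) * f ((w ⊕ z) ⊕ u)
  expand : ∀ a b c d → (a + b) * (c + d) ≡ a * c + a * d + (b * c + b * d)
  expand = solve-∀
  collect : ∀ a b → a + b + (b + a) ≡ 2 * (a + b)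
  collect = solve-∀

corr-comm : ∀ {r} (f g : V r → ℕ) z → corr f g z ≡ corr g f z
corr-comm f g z = trans (sym (∑-shift (λ w → f w * g (w ⊕ z)) z))
  (∑-cong (λ w → trans (cong (λ t → f (w ⊕ z) * g t) (⊕-cancelʳ w z)) (*-comm (f (w ⊕ z)) (g w))))

-- Distinct terms of a sum and disjoint translates

three-terms≤∑ : ∀ {r} (f : V r → ℕ) {x y z : V r} → x ≢ y → x ≢ z → y ≢ z → f x + f y + f z ≤ ∑ f
three-terms≤∑ f {x} {y} {z} x≢y x≢z y≢z = subst (_≤ ∑ f) total (∑-mono pointwise)
  where
  h : _ → ℕ
  h w = pt x w * f w + pt y w * f w + pt z w * f w
  total : ∑ h ≡ f x + f y + f z
  total = trans (∑-+ _ _) (cong₂ _+_ (trans (∑-+ _ _) (cong₂ _+_ (∑-pt* x f) (∑-pt* y f))) (∑-pt* z f))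
  pointwise : ∀ w → h w ≤ f w
  pointwise w with w ≟ⱽ x | w ≟ⱽ y | w ≟ⱽ z
  ... | yes refl | yes q    | _        = ⊥-elim (x≢y q)
  ... | yes refl | no _     | yes q    = ⊥-elim (x≢z q)
  ... | no _     | yes refl | yes q    = ⊥-elim (y≢z q)
  ... | yes refl | no p     | no q     rewrite pt-same w | pt-distinct p | pt-distinct q =
        ≤-reflexive (unitˡ (f w))
    where unitˡ : ∀ a → 1 * a + 0 * a + 0 * a ≡ a
          unitˡ = solve-∀
  ... | no p     | yes refl | no q     rewrite pt-same w | pt-distinct p | pt-distinct q =
        ≤-reflexive (unitᵐ (f w))
    where unitᵐ : ∀ a → 0 * a + 1 * a + 0 * a ≡ a
          unitᵐ = solve-∀
  ... | no p     | no q     | yes refl rewrite pt-same w | pt-distinct p | pt-distinct q =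
        ≤-reflexive (unitʳ (f w))
    where unitʳ : ∀ a → 0 * a + 0 * a + 1 * a ≡ a
          unitʳ = solve-∀
  ... | no p     | no q     | no s     rewrite pt-distinct p | pt-distinct q | pt-distinct s = z≤n

-- The hypotheses make `X`, `Y`, `Z` and their shifts by `s` six pairwise disjoint sets; the pairs
-- that are not listed are shifts by `s` of listed ones.
three-packing : ∀ {r} s (X Y Z : Subset₂ r) →
  let Apart : Subset₂ r → Subset₂ r → Set
      Apart P Q = ∀ w → P w ≡ true → (Q w ≡ true → ⊥) × (Q (w ⊕ s) ≡ true → ⊥)
      Self : Subset₂ r → Set
      Self P = ∀ w → P w ≡ true → P (w ⊕ s) ≡ true → ⊥ in
  Self X → Self Y → Self Z → Apart X Y → Apart X Z → Apart Y Z →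
  2 * (∑ (χ X) + ∑ (χ Y) + ∑ (χ Z)) ≤ 2 ^ r
three-packing {r} s X Y Z sX sY sZ aXY aXZ aYZ =
  subst₂ _≤_ (trans (∑-+ _ _) (trans (cong₂ _+_ (trans (∑-+ _ _) (cong₂ _+_ (∑-fold X) (∑-fold Y))) (∑-fold Z))
                (collect (∑ (χ X)) (∑ (χ Y)) (∑ (χ Z)))))
             (trans (∑-const r 1) (*-identityʳ _)) (∑-mono pointwise)
  where
  fold : Subset₂ r → V r → ℕ
  fold P w = χ P w + χ P (w ⊕ s)
  ∑-fold : ∀ P → ∑ (fold P) ≡ ∑ (χ P) + ∑ (χ P)
  ∑-fold P = trans (∑-+ _ _) (cong (∑ (χ P) +_) (∑-shift (χ P) s))
  collect : ∀ a b c → a + a + (b + b) + (c + c) ≡ 2 * (a + b + c)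
  collect = solve-∀
  fold≤1 : ∀ P → (∀ w → P w ≡ true → P (w ⊕ s) ≡ true → ⊥) → ∀ w → fold P w ≤ 1
  fold≤1 P self w with P w in p
  ... | false = 𝟙≤1 _
  ... | true rewrite ≢true⇒false (self w p) = ≤-refl
  exclusive : ∀ P Q → (∀ w → P w ≡ true → (Q w ≡ true → ⊥) × (Q (w ⊕ s) ≡ true → ⊥)) →
              ∀ w → fold P w ≡ 0 ⊎ fold Q w ≡ 0
  exclusive P Q apart w with P w in p
  ... | true = inj₂ (cong₂ (λ b c → 𝟙 b + 𝟙 c) (≢true⇒false (proj₁ (apart w p))) (≢true⇒false (proj₂ (apart w p))))
  ... | false with P (w ⊕ s) in p′
  ... | false = inj₁ refl
  ... | true = inj₂ (cong₂ (λ b c → 𝟙 b + 𝟙 c)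
        (≢true⇒false (λ q → proj₂ (apart (w ⊕ s) p′) (trans (cong Q (⊕-cancelʳ w s)) q)))
        (≢true⇒false (proj₁ (apart (w ⊕ s) p′))))
  bits : ∀ a b c → a ≤ 1 → b ≤ 1 → c ≤ 1 → a ≡ 0 ⊎ b ≡ 0 → a ≡ 0 ⊎ c ≡ 0 → b ≡ 0 ⊎ c ≡ 0 → a + b + c ≤ 1
  bits a b c pa pb pc (inj₁ refl) _ (inj₁ refl) = pc
  bits a b c pa pb pc (inj₁ refl) _ (inj₂ refl) = ≤-trans (≤-reflexive (+-identityʳ b)) pb
  bits a b c pa pb pc (inj₂ refl) (inj₁ refl) _ = pc
  bits a b c pa pb pc (inj₂ refl) (inj₂ refl) _ = ≤-trans (≤-reflexive (trans (+-identityʳ _) (+-identityʳ a))) pa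
  pointwise : ∀ w → fold X w + fold Y w + fold Z w ≤ 1
  pointwise w = bits (fold X w) (fold Y w) (fold Z w) (fold≤1 X sX w) (fold≤1 Y sY w) (fold≤1 Z sZ w)
    (exclusive X Y aXY w) (exclusive X Z aXZ w) (exclusive Y Z aYZ w)

-- Numerical inequalities

-- For `a` and `a′` in 0, 1 this is `y y′ ≤ (1 - a)(1 - a′)`. The errors `e` and `e′` absorb the
-- value 2, which occurs only on the class where the ends of the edge collide.
packing-pointwise : ∀ a a′ y y′ e e′ → a ≤ 1 + e → a′ ≤ 1 + e′ → y ≤ 1 → y′ ≤ 1 →
                    y ≡ 0 ⊎ a ≡ 0 → y′ ≡ 0 ⊎ a′ ≡ 0 → y * y′ + (a + a′) ≤ 1 + a * a′ + (e + e′)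
packing-pointwise zero zero y y′ e e′ _ _ y≤1 y′≤1 _ _ =
  ≤-trans (≤-reflexive (+-identityʳ _)) (≤-trans (*-mono-≤ y≤1 y′≤1) (m≤m+n 1 _))
packing-pointwise zero (suc a′) y y′ e e′ _ a′≤ _ _ _ (inj₁ refl) rewrite *-zeroʳ y =
  ≤-trans a′≤ (s≤s (m≤n+m e′ e))
packing-pointwise (suc a) zero y y′ e e′ a≤ _ _ _ (inj₁ refl) _ rewrite *-zeroʳ a | +-identityʳ a =
  ≤-trans a≤ (s≤s (m≤m+n e e′))
packing-pointwise (suc a) (suc a′) y y′ e e′ _ _ _ _ (inj₁ refl) _ =
  ≤-trans (≤-trans (m≤m+n _ (a * a′)) (≤-reflexive (product a a′))) (m≤m+n _ (e + e′))
  where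
  product : ∀ a b → suc a + suc b + a * b ≡ 1 + suc a * suc b
  product = solve-∀

-- The difference of the two sides is `(b - a)(d - c)`.
rearrangement : ∀ {a b c d} → a ≤ b → c ≤ d → b * c + a * d ≤ b * d + a * c
rearrangement {a} {b} {c} {d} p q with m≤n⇒∃[o]m+o≡n p | m≤n⇒∃[o]m+o≡n q
... | o , refl | o′ , refl = ≤-trans (m≤m+n _ (o * o′)) (≤-reflexive (expand a o c o′))
  where
  expand : ∀ a o c o′ → (a + o) * c + a * (c + o′) + o * o′ ≡ (a + o) * (c + o′) + a * c
  expand = solve-∀

-- A combination of the five hypotheses whose slack is a polynomial with positive coefficients.
-- Numerals stand on the right of products because `180 * x` would unfold.
quadratic-contradiction : ∀ k₃ q b t s →
  (k₃ * ((k₃ + q) + b + t) * 3 + ((t + s + 6) * 5 + (k₃ + q) * 2 + b * 3 + k₃ + (t + s + 6) * ((k₃ + q) + b + t))) ≤ (((k₃ + q) * 3 + b * 2 + t + s) * (t + s + 6) * 2 + ((k₃ + q) + b + t) * 2 + b * ((k₃ + q) * 2 + b) + (k₃ * k₃ + k₃ * 3)) →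
  (q * 2) ≤ (b + t * 2) → 2 ≤ (k₃ + q) →
  b * 14 + t * 43 + s * 43 + 240 ≤ (k₃ + q) * 15 →
  b * 4 + t * 11 + s * 11 + 33 ≤ (k₃ + q) * 3 → ⊥
quadratic-contradiction k₃ q b t s main Q≤B 2≤k lower₁₅ lower₃ =
  <⇒≱ (subst (total₂ <_) (sym (certificate k₃ q b t s)) (m<m+n total₂ (≤-trans (s≤s z≤n) (m≤n+m 5400 _))))
      (+-mono-≤ (+-mono-≤ (+-mono-≤ (+-mono-≤
        (*-monoˡ-≤ 180 main)
        (*-monoˡ-≤ 45 (*-monoˡ-≤ (b * 6 + t * 6 + (b + t * 2) + (q * 2)) Q≤B)))
        (*-monoˡ-≤ 90 (rearrangement Q≤B 2≤k)))
        (*-monoˡ-≤ 24 (*-monoʳ-≤ (k₃ + q) lower₁₅)))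
        (*-monoʳ-≤ (b * 142 + s * 44 + t * 164) lower₃))
  where
  total₂ : ℕ
  total₂ = (((k₃ + q) * 3 + b * 2 + t + s) * (t + s + 6) * 2 + ((k₃ + q) + b + t) * 2 + b * ((k₃ + q) * 2 + b) + (k₃ * k₃ + k₃ * 3)) * 180
    + (b + t * 2) * (b * 6 + t * 6 + (b + t * 2) + (q * 2)) * 45 + ((b + t * 2) * (k₃ + q) + (q * 2) * 2) * 90
    + (k₃ + q) * ((k₃ + q) * 15) * 24 + (b * 142 + s * 44 + t * 164) * ((k₃ + q) * 3)
  certificate : ∀ k₃ q b t s →
    (k₃ * ((k₃ + q) + b + t) * 3 + ((t + s + 6) * 5 + (k₃ + q) * 2 + b * 3 + k₃ + (t + s + 6) * ((k₃ + q) + b + t))) * 180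
    + (q * 2) * (b * 6 + t * 6 + (b + t * 2) + (q * 2)) * 45 + ((b + t * 2) * 2 + (q * 2) * (k₃ + q)) * 90
    + (k₃ + q) * (b * 14 + t * 43 + s * 43 + 240) * 24
    + (b * 142 + s * 44 + t * 164) * (b * 4 + t * 11 + s * 11 + 33)
    ≡ (((k₃ + q) * 3 + b * 2 + t + s) * (t + s + 6) * 2 + ((k₃ + q) + b + t) * 2 + b * ((k₃ + q) * 2 + b) + (k₃ * k₃ + k₃ * 3)) * 180
    + (b + t * 2) * (b * 6 + t * 6 + (b + t * 2) + (q * 2)) * 45 + ((b + t * 2) * (k₃ + q) + (q * 2) * 2) * 90
    + (k₃ + q) * ((k₃ + q) * 15) * 24 + (b * 142 + s * 44 + t * 164) * ((k₃ + q) * 3)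
    + (b * 1806 + b * b * 73 + b * s * 1198 + b * t * 688 + s * 192 + s * s * 124
       + s * t * 1748 + t * 5232 + t * t * 904 + 5400)
  certificate = solve-∀

-- Substituting m = k + b + t, M + 2 = m + n + s and k = k₃ + q leads to quadratic-contradiction.
sparse-arithmetic : ∀ M n m k b k₃ D C →
  n ≡ 2 * k + b → k + b ≤ m → D + b ≤ 2 * m → 4 * k ≤ 2 * k₃ + D → k₃ ≤ k →
  2 * n + C ≡ M + 8 + k → m + n ≤ M + 2 → 11 * M + 54 < 18 * n → 128 ≤ M ⊎ 11 * M + 70 ≤ 18 * n →
  3 * (k₃ * m) + ((C + 2 * k + b + k₃) + (C * m + b)) ≤ 2 * M * C + D + b * n + k₃ * k₃ + 3 * k₃ → ⊥
sparse-arithmetic M n m k b k₃ D C refl k+b≤m D+b≤2m 4k≤ k₃≤k C-eq m+n≤ large M-large main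
  with m≤n⇒∃[o]m+o≡n k+b≤m | m≤n⇒∃[o]m+o≡n k₃≤k
... | t , refl | q , refl with m≤n⇒∃[o]m+o≡n m+n≤
... | s , M-eq = quadratic-contradiction k₃ q b t s main′ Q≤B 2≤k lower₁₅ lower₃
  where
  open ≤-Reasoning
  -- `C` is the loss suffered at each of the `2 M` values of `z` in the count; it is small because
  -- it is made up of the slacks `t` and `s` alone.
  C≡ : C ≡ t + s + 6
  C≡ = +-cancelʳ-≡ ((k₃ + q) * 4 + b * 2 + 2) C (t + s + 6) (trans (id₁ k₃ q b C) (trans (cong (_+ 2) C-eq)
         (trans (id₂ M (k₃ + q)) (trans (cong (λ v → v + 8 + (k₃ + q)) (sym M-eq)) (id₃ k₃ q b t s)))))
    where
    id₁ : ∀ k₃ q b C → C + ((k₃ + q) * 4 + b * 2 + 2) ≡ 2 * (2 * (k₃ + q) + b) + C + 2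
    id₁ = solve-∀
    id₂ : ∀ M k → M + 8 + k + 2 ≡ M + 2 + 8 + k
    id₂ = solve-∀
    id₃ : ∀ k₃ q b t s → (k₃ + q) + b + t + (2 * (k₃ + q) + b) + s + 8 + (k₃ + q) ≡ t + s + 6 + ((k₃ + q) * 4 + b * 2 + 2)
    id₃ = solve-∀
  -- In the new variables `M + 2 = 3 k + 2 b + t + s` and `n = 2 k + b`, so `18 n - 11 (M + 2) = 3 k
  -- - 4 b - 11 t - 11 s`.
  lower : ∀ c → 11 * M + (22 + c) ≤ 18 * (2 * (k₃ + q) + b) → b * 4 + t * 11 + s * 11 + c ≤ (k₃ + q) * 3
  lower c p = +-cancelʳ-≤ ((k₃ + q) * 33 + b * 22 + 22) _ _ (begin
    b * 4 + t * 11 + s * 11 + c + ((k₃ + q) * 33 + b * 22 + 22)        ≡⟨ id₁ k₃ q b t s c ⟩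
    ((k₃ + q) + b + t + (2 * (k₃ + q) + b) + s) * 11 + (22 + c) + b * 4     ≡⟨ cong (λ v → v * 11 + (22 + c) + b * 4) M-eq ⟩
    (M + 2) * 11 + (22 + c) + b * 4                               ≡⟨ id₂ M b c ⟩
    11 * M + (22 + c) + (b * 4 + 22)                              ≤⟨ +-monoˡ-≤ (b * 4 + 22) p ⟩
    18 * (2 * (k₃ + q) + b) + (b * 4 + 22)                             ≡⟨ id₃ k₃ q b ⟩
    (k₃ + q) * 3 + ((k₃ + q) * 33 + b * 22 + 22)                            ∎)
    where
    id₁ : ∀ k₃ q b t s c → b * 4 + t * 11 + s * 11 + c + ((k₃ + q) * 33 + b * 22 + 22)
          ≡ ((k₃ + q) + b + t + (2 * (k₃ + q) + b) + s) * 11 + (22 + c) + b * 4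
    id₁ = solve-∀
    id₂ : ∀ M b c → (M + 2) * 11 + (22 + c) + b * 4 ≡ 11 * M + (22 + c) + (b * 4 + 22)
    id₂ = solve-∀
    id₃ : ∀ k₃ q b → 18 * (2 * (k₃ + q) + b) + (b * 4 + 22) ≡ (k₃ + q) * 3 + ((k₃ + q) * 33 + b * 22 + 22)
    id₃ = solve-∀
  lower₃ : b * 4 + t * 11 + s * 11 + 33 ≤ (k₃ + q) * 3
  lower₃ = lower 33 (≤-trans (≤-reflexive (+-suc (11 * M) 54)) large)
  2≤k : 2 ≤ (k₃ + q)
  2≤k = *-cancelʳ-≤ 2 (k₃ + q) 3 (≤-trans (≤-trans (m≤m+n 6 27) (m≤n+m 33 _)) lower₃)
  -- Five copies of `lower₃` reach only the constant 165. The rest comes either from `128 ≤ M`, used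
  -- as a fifth summand, or from 48 in place of 33, as `5 * 48 = 240`.
  lower₁₅ : b * 14 + t * 43 + s * 43 + 240 ≤ (k₃ + q) * 15
  lower₁₅ = go M-large
    where
    go : 128 ≤ M ⊎ 11 * M + 70 ≤ 18 * (2 * (k₃ + q) + b) → b * 14 + t * 43 + s * 43 + 240 ≤ (k₃ + q) * 15
    go (inj₁ p) = +-cancelʳ-≤ (b * 2 + t + s + 22) _ _ (begin
      b * 14 + t * 43 + s * 43 + 240 + (b * 2 + t + s + 22)     ≡⟨ id₁ b t s ⟩
      (b * 4 + t * 11 + s * 11 + 33) * 4 + 130                  ≤⟨ +-mono-≤ (*-monoˡ-≤ 4 lower₃)
                                                                     (+-monoˡ-≤ 2 p) ⟩
      (k₃ + q) * 3 * 4 + (M + 2)                                     ≡⟨ cong ((k₃ + q) * 3 * 4 +_) (sym M-eq) ⟩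
      (k₃ + q) * 3 * 4 + ((k₃ + q) + b + t + (2 * (k₃ + q) + b) + s)           ≡⟨ id₂ k₃ q b t s ⟩
      (k₃ + q) * 15 + (b * 2 + t + s)                                ≤⟨ +-monoʳ-≤ ((k₃ + q) * 15) (m≤m+n _ 22) ⟩
      (k₃ + q) * 15 + (b * 2 + t + s + 22)                           ∎)
      where
      id₁ : ∀ b t s → b * 14 + t * 43 + s * 43 + 240 + (b * 2 + t + s + 22)
            ≡ (b * 4 + t * 11 + s * 11 + 33) * 4 + 130
      id₁ = solve-∀
      id₂ : ∀ k₃ q b t s → (k₃ + q) * 3 * 4 + ((k₃ + q) + b + t + (2 * (k₃ + q) + b) + s) ≡ (k₃ + q) * 15 + (b * 2 + t + s)
      id₂ = solve-∀
    go (inj₂ p) = begin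
      b * 14 + t * 43 + s * 43 + 240                            ≤⟨ m≤m+n _ (b * 6 + t * 12 + s * 12) ⟩
      b * 14 + t * 43 + s * 43 + 240 + (b * 6 + t * 12 + s * 12) ≡⟨ id₁ b t s ⟩
      (b * 4 + t * 11 + s * 11 + 48) * 5                        ≤⟨ *-monoˡ-≤ 5 (lower 48 p) ⟩
      (k₃ + q) * 3 * 5                                               ≡⟨ *-assoc (k₃ + q) 3 5 ⟩
      (k₃ + q) * 15                                                  ∎
      where
      id₁ : ∀ b t s → b * 14 + t * 43 + s * 43 + 240 + (b * 6 + t * 12 + s * 12)
            ≡ (b * 4 + t * 11 + s * 11 + 48) * 5
      id₁ = solve-∀
  -- `q` counts the matching edges with degree sum at least 4; their surplus degree has to be paid
  -- for by `b` and `t`.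
  Q≤B : (q * 2) ≤ (b + t * 2)
  Q≤B = +-cancelʳ-≤ (k₃ * 4 + q * 2 + b) _ _ (begin
    (q * 2) + (k₃ * 4 + q * 2 + b)          ≡⟨ id₁ k₃ q b ⟩
    4 * (k₃ + q) + b                         ≤⟨ +-monoˡ-≤ b 4k≤ ⟩
    2 * k₃ + D + b                      ≡⟨ +-assoc (2 * k₃) D b ⟩
    2 * k₃ + (D + b)                    ≤⟨ +-monoʳ-≤ (2 * k₃) D+b≤2m ⟩
    2 * k₃ + 2 * ((k₃ + q) + b + t)          ≡⟨ id₂ k₃ q b t ⟩
    (b + t * 2) + (k₃ * 4 + q * 2 + b)          ∎)
    where
    id₁ : ∀ k₃ q b → (q * 2) + (k₃ * 4 + q * 2 + b) ≡ 4 * (k₃ + q) + b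
    id₁ = solve-∀
    id₂ : ∀ k₃ q b t → 2 * k₃ + 2 * ((k₃ + q) + b + t) ≡ (b + t * 2) + (k₃ * 4 + q * 2 + b)
    id₂ = solve-∀
  main′ : (k₃ * ((k₃ + q) + b + t) * 3 + ((t + s + 6) * 5 + (k₃ + q) * 2 + b * 3 + k₃ + (t + s + 6) * ((k₃ + q) + b + t))) ≤ (((k₃ + q) * 3 + b * 2 + t + s) * (t + s + 6) * 2 + ((k₃ + q) + b + t) * 2 + b * ((k₃ + q) * 2 + b) + (k₃ * k₃ + k₃ * 3))
  main′ = begin
    (k₃ * ((k₃ + q) + b + t) * 3 + ((t + s + 6) * 5 + (k₃ + q) * 2 + b * 3 + k₃ + (t + s + 6) * ((k₃ + q) + b + t)))
      ≡⟨ cong (λ c → k₃ * ((k₃ + q) + b + t) * 3 + (c * 5 + (k₃ + q) * 2 + b * 3 + k₃ + c * ((k₃ + q) + b + t))) (sym C≡) ⟩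
    k₃ * ((k₃ + q) + b + t) * 3 + (C * 5 + (k₃ + q) * 2 + b * 3 + k₃ + C * ((k₃ + q) + b + t))
      ≡⟨ id₁ k₃ (k₃ + q) ((k₃ + q) + b + t) b C ⟩
    3 * (k₃ * ((k₃ + q) + b + t)) + ((C + 2 * (k₃ + q) + b + k₃) + (C * ((k₃ + q) + b + t) + b)) + (b + C * 4)
      ≤⟨ +-monoˡ-≤ (b + C * 4) main ⟩
    2 * M * C + D + b * (2 * (k₃ + q) + b) + k₃ * k₃ + 3 * k₃ + (b + C * 4)
      ≡⟨ id₂ M C D b (b * (2 * (k₃ + q) + b)) (k₃ * k₃) k₃ ⟩
    (M + 2) * C * 2 + (D + b) + b * (2 * (k₃ + q) + b) + (k₃ * k₃ + k₃ * 3)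
      ≤⟨ +-monoˡ-≤ (k₃ * k₃ + k₃ * 3) (+-monoˡ-≤ (b * (2 * (k₃ + q) + b)) (+-monoʳ-≤ ((M + 2) * C * 2) D+b≤2m)) ⟩
    (M + 2) * C * 2 + 2 * ((k₃ + q) + b + t) + b * (2 * (k₃ + q) + b) + (k₃ * k₃ + k₃ * 3)
      ≡⟨ cong₂ (λ v c → v * c * 2 + 2 * ((k₃ + q) + b + t) + b * (2 * (k₃ + q) + b) + (k₃ * k₃ + k₃ * 3)) (sym M-eq) C≡ ⟩
    ((k₃ + q) + b + t + (2 * (k₃ + q) + b) + s) * (t + s + 6) * 2 + 2 * ((k₃ + q) + b + t) + b * (2 * (k₃ + q) + b) + (k₃ * k₃ + k₃ * 3)
      ≡⟨ id₃ k₃ q b t s ⟩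
    (((k₃ + q) * 3 + b * 2 + t + s) * (t + s + 6) * 2 + ((k₃ + q) + b + t) * 2 + b * ((k₃ + q) * 2 + b) + (k₃ * k₃ + k₃ * 3)) ∎
    where
    id₁ : ∀ k₃ k m b C → k₃ * m * 3 + (C * 5 + k * 2 + b * 3 + k₃ + C * m)
          ≡ 3 * (k₃ * m) + ((C + 2 * k + b + k₃) + (C * m + b)) + (b + C * 4)
    id₁ = solve-∀
    id₂ : ∀ M C D b x y k₃ → 2 * M * C + D + x + y + 3 * k₃ + (b + C * 4)
          ≡ (M + 2) * C * 2 + (D + b) + x + (y + k₃ * 3)
    id₂ = solve-∀
    id₃ : ∀ k₃ q b t s →
      ((k₃ + q) + b + t + (2 * (k₃ + q) + b) + s) * (t + s + 6) * 2 + 2 * ((k₃ + q) + b + t) + b * (2 * (k₃ + q) + b) + (k₃ * k₃ + k₃ * 3)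
      ≡ (((k₃ + q) * 3 + b * 2 + t + s) * (t + s + 6) * 2 + ((k₃ + q) + b + t) * 2 + b * ((k₃ + q) * 2 + b) + (k₃ * k₃ + k₃ * 3))
    id₃ = solve-∀

-- Up to `2 ^ j = 32` the integer `n` forced by the first hypothesis violates the second. At 64 the
-- first gives `n ≥ 43`, and `18 * 43 = 11 * 64 + 70` exactly.
power-of-two-bound : ∀ j n → 11 * 2 ^ j + 54 < 18 * n → 3 * n ≤ 2 * 2 ^ j + 4 →
                     128 ≤ 2 ^ j ⊎ 11 * 2 ^ j + 70 ≤ 18 * n
power-of-two-bound j n large small = go j refl
  where
  n> : ∀ c → 18 * c ≤ 11 * 2 ^ j + 54 → c < n
  n> c p = *-cancelˡ-< 18 c n (≤-<-trans p large)
  absurd : ∀ c → 18 * c ≤ 11 * 2 ^ j + 54 → 2 * 2 ^ j + 4 < 3 * suc c → ⊥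
  absurd c p q = <-irrefl refl (<-≤-trans q (≤-trans (*-monoʳ-≤ 3 (n> c p)) small))
  go : ∀ i → i ≡ j → 128 ≤ 2 ^ j ⊎ 11 * 2 ^ j + 70 ≤ 18 * n
  go 0 refl = ⊥-elim (absurd 3 (m≤m+n _ 11) (m≤m+n _ 5))
  go 1 refl = ⊥-elim (absurd 4 (m≤m+n _ 4) (m≤m+n _ 6))
  go 2 refl = ⊥-elim (absurd 5 (m≤m+n _ 8) (m≤m+n _ 5))
  go 3 refl = ⊥-elim (absurd 7 (m≤m+n _ 16) (m≤m+n _ 3))
  go 4 refl = ⊥-elim (absurd 12 (m≤m+n _ 14) (m≤m+n _ 2))
  go 5 refl = ⊥-elim (absurd 22 (m≤m+n _ 10) (m≤m+n _ 0))
  go 6 refl = inj₂ (*-monoʳ-≤ 18 (n> 42 (m≤m+n _ 2)))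
  go (suc (suc (suc (suc (suc (suc (suc i))))))) refl = inj₁ (^-monoʳ-≤ 2 {7} {7 + i} (m≤m+n 7 i))

-- If `k` were at least 3, then 18 times `k τ + b ≤ 2 m`, 18 times `k + b ≤ m` and 5 times the size
-- bound would add up to `18 (k - 3)(τ - 3) + M + 113 ≤ 0`.
matching-size≤2 : ∀ M n m k b D τ → n ≡ 2 * k + b → k + b ≤ m → D + b ≤ 2 * m → k * τ ≤ D →
                 m + n ≡ M + τ → 3 ≤ τ → 11 * M + 54 < 18 * n → k ≤ 2
matching-size≤2 M n m k b D τ n≡ k+b≤m D+b≤2m kτ≤D eq 3≤τ large with k ≤? 2
... | yes p = p
... | no p = ⊥-elim (<⇒≱ strict sum)
  where
  i j : ℕ
  i = k ∸ 3
  j = τ ∸ 3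
  i+3≡k : i + 3 ≡ k
  i+3≡k = m∸n+n≡m (≰⇒> p)
  j+3≡τ : j + 3 ≡ τ
  j+3≡τ = m∸n+n≡m 3≤τ
  sum : (k * τ + b) * 18 + (k + b) * 18 + (11 * M + 55) * 5 ≤ 2 * m * 18 + m * 18 + 18 * n * 5
  sum = +-mono-≤ (+-mono-≤ (*-monoˡ-≤ 18 (≤-trans (+-monoˡ-≤ b kτ≤D) D+b≤2m)) (*-monoˡ-≤ 18 k+b≤m))
          (*-monoˡ-≤ 5 (≤-trans (≤-reflexive (+-suc (11 * M) 54)) large))
  id₁ : ∀ m n → 2 * m * 18 + m * 18 + 18 * n * 5 ≡ (m + n) * 54 + n * 36
  id₁ = solve-∀
  id₂ : ∀ M i j b → ((i + 3) * (j + 3) + b) * 18 + (i + 3 + b) * 18 + (11 * M + 55) * 5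
        ≡ (M + (j + 3)) * 54 + (2 * (i + 3) + b) * 36 + (i * j * 18 + M + 113)
  id₂ = solve-∀
  id₃ : (k * τ + b) * 18 + (k + b) * 18 + (11 * M + 55) * 5 ≡ (M + τ) * 54 + (2 * k + b) * 36 + (i * j * 18 + M + 113)
  id₃ = subst₂ (λ k τ → (k * τ + b) * 18 + (k + b) * 18 + (11 * M + 55) * 5
                        ≡ (M + τ) * 54 + (2 * k + b) * 36 + (i * j * 18 + M + 113)) i+3≡k j+3≡τ (id₂ M i j b)
  strict : 2 * m * 18 + m * 18 + 18 * n * 5 < (k * τ + b) * 18 + (k + b) * 18 + (11 * M + 55) * 5
  strict = subst₂ _<_ (sym (trans (id₁ m n) (cong₂ (λ s t → s * 54 + t * 36) eq n≡))) (sym id₃)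
             (m<m+n _ (≤-trans (s≤s z≤n) (m≤n+m 113 (i * j * 18 + M))))

-- Here `2 n = (k + b + n) + k ≤ M + τ + 2`, while `18 n` exceeds `9 M + 54`; hence `9 τ > 36`. The
-- gain over `3 ≤ τ` is that every edge gets an end of degree at least 3.
large-degrees : ∀ M n m k b τ → n ≡ 2 * k + b → k + b ≤ m → m + n ≡ M + τ → k ≤ 2 →
                11 * M + 54 < 18 * n → 5 ≤ τ
large-degrees M n m k b τ n≡ k+b≤m eq k≤2 large = *-cancelʳ-< 9 4 τ (+-cancelʳ-≤ (9 * M + 18) 37 (τ * 9) (begin
  37 + (9 * M + 18)          ≡⟨ id₁ M ⟩
  9 * M + 55                 ≤⟨ +-monoˡ-≤ 55 (*-monoˡ-≤ M {9} {11} (m≤m+n 9 2)) ⟩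
  11 * M + 55                ≤⟨ ≤-trans (≤-reflexive (+-suc (11 * M) 54)) large ⟩
  18 * n                     ≡⟨ id₂ n ⟩
  (n + n) * 9                ≤⟨ *-monoˡ-≤ 9 (begin
      n + n                    ≡⟨ cong (_+ n) n≡ ⟩
      2 * k + b + n            ≡⟨ id₃ k b n ⟩
      k + b + n + k            ≤⟨ +-mono-≤ (+-monoˡ-≤ n k+b≤m) k≤2 ⟩
      m + n + 2                ≡⟨ cong (_+ 2) eq ⟩
      M + τ + 2                ∎) ⟩
  (M + τ + 2) * 9            ≡⟨ id₄ M τ ⟩
  τ * 9 + (9 * M + 18)       ∎))
  where
  open ≤-Reasoning
  id₁ : ∀ M → 37 + (9 * M + 18) ≡ 9 * M + 55
  id₁ = solve-∀
  id₂ : ∀ n → 18 * n ≡ (n + n) * 9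
  id₂ = solve-∀
  id₃ : ∀ k b n → 2 * k + b + n ≡ k + b + n + k
  id₃ = solve-∀
  id₄ : ∀ M τ → (M + τ + 2) * 9 ≡ τ * 9 + (9 * M + 18)
  id₄ = solve-∀

-- The graph of unique sums

module Graph {r} (A : Subset₂ r) (M : ℕ) (2^r≡2M : 2 ^ r ≡ 2 * M) (large : 11 * M + 54 < 18 * ∑ (χ A)) where

  α : V r → ℕ
  α = χ A

  n : ℕ
  n = ∑ α

  rep : V r → ℕ
  rep = corr α α

  -- `rep` counts ordered pairs, so one unordered pair of distinct summands gives 2; `𝟎` stays
  -- outside because `rep 𝟎 = n > 3`.
  U : Subset₂ r
  U z = rep z ≡ᵇ 2

  μ : V r → ℕ
  μ = χ U

  m : ℕ
  m = ∑ μ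

  -- For `x` in `A` this is the degree in the graph: a unique sum determines its edge, so edges are
  -- counted by their sums.
  deg : V r → ℕ
  deg = corr μ α

  rep≡2 : ∀ {z} → U z ≡ true → rep z ≡ 2
  rep≡2 {z} p = ≡ᵇ⇒≡ (rep z) 2 (subst T (sym p) tt)

  rep≡2⇒U : ∀ {z} → rep z ≡ 2 → U z ≡ true
  rep≡2⇒U p = cong (_≡ᵇ 2) p

  3<n : 3 < n
  3<n = *-cancelˡ-< 18 3 n (≤-<-trans (m≤n+m 54 (11 * M)) large)

  rep-𝟎 : rep 𝟎 ≡ n
  rep-𝟎 = trans (corr-𝟎 α α) (∑-cong (λ w → idem (A w)))
    where
    idem : ∀ b → 𝟙 b * 𝟙 b ≡ 𝟙 b
    idem true  = refl
    idem false = refl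

  U⇒≢𝟎 : ∀ {u} → U u ≡ true → u ≢ 𝟎
  U⇒≢𝟎 p refl = <⇒≢ (<-trans (n<1+n 2) 3<n) (trans (sym (rep≡2 p)) rep-𝟎)

  Edge : V r → V r → Set
  Edge x u = A x ≡ true × A (x ⊕ u) ≡ true × U u ≡ true

  edge-flip : ∀ {x u} → Edge x u → Edge (x ⊕ u) u
  edge-flip {x} {u} (p , q , s) = q , trans (cong A (⊕-cancelʳ x u)) p , s

  ends-distinct : ∀ {x u} → Edge x u → x ≢ x ⊕ u
  ends-distinct {x} {u} (_ , _ , p) q = U⇒≢𝟎 p
    (trans (xor-solve (u ∷ x ∷ []) x₀ (x₁ ⊞ (x₁ ⊞ x₀)) refl) (trans (cong (x ⊕_) (sym q)) (⊕-self x)))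

  -- The two ends already exhaust `rep u = 2`; another `a` would contribute a third term.
  edge-indicator : ∀ {x u} → Edge x u → ∀ a → α a * α (a ⊕ u) ≡ pt x a + pt (x ⊕ u) a
  edge-indicator {x} {u} (p , q , s) a with a ≟ⱽ x | a ≟ⱽ (x ⊕ u)
  ... | yes refl | yes t = ⊥-elim (ends-distinct (p , q , s) t)
  ... | yes refl | no t = trans (cong₂ (λ b c → 𝟙 b * 𝟙 c) p q)
                            (sym (cong₂ _+_ (pt-same a) (pt-distinct t)))
  ... | no t | yes refl = trans (cong₂ (λ b c → 𝟙 b * 𝟙 c) q (trans (cong A (⊕-cancelʳ x u)) p))
                            (sym (cong₂ _+_ (pt-distinct t) (pt-same (x ⊕ u))))
  ... | no t | no t′ = trans (n≤0⇒n≡0 (+-cancelˡ-≤ 2 _ 0 three))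
                         (sym (cong₂ _+_ (pt-distinct t) (pt-distinct t′)))
    where
    f : V r → ℕ
    f b = α b * α (b ⊕ u)
    fx : f x ≡ 1
    fx = cong₂ (λ b c → 𝟙 b * 𝟙 c) p q
    fxu : f (x ⊕ u) ≡ 1
    fxu = cong₂ (λ b c → 𝟙 b * 𝟙 c) q (trans (cong A (⊕-cancelʳ x u)) p)
    three : 2 + f a ≤ 2
    three = subst₂ _≤_ (cong₂ (λ i j → i + j + f a) fx fxu) (rep≡2 s)
              (three-terms≤∑ f (ends-distinct (p , q , s)) (λ z → t (sym z)) (λ z → t′ (sym z)))

  edge-unique : ∀ {x u b} → Edge x u → A b ≡ true → A (b ⊕ u) ≡ true → b ≡ x ⊎ b ≡ x ⊕ u
  edge-unique {x} {u} {b} e p q with b ≟ⱽ x | b ≟ⱽ (x ⊕ u)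
  ... | yes t | _     = inj₁ t
  ... | no _  | yes t = inj₂ t
  ... | no t  | no t′ = ⊥-elim (1+n≢0 (trans (sym (cong₂ (λ b c → 𝟙 b * 𝟙 c) p q))
                          (trans (edge-indicator e b) (cong₂ _+_ (pt-distinct t) (pt-distinct t′)))))

  -- Expresses the sum of `φ` over the ends of an edge through `u` alone, so that sums over `U` can
  -- be formed without choosing ends.
  edge-sum : ∀ {x u} → Edge x u → (φ : V r → ℕ) → corr (λ a → α a * φ a) α u ≡ φ x + φ (x ⊕ u)
  edge-sum {x} {u} e φ = begin
    ∑ (λ a → α a * φ a * α (a ⊕ u))                          ≡⟨ ∑-cong (λ a →
        trans (rearrange (α a) (φ a) (α (a ⊕ u)))
        (trans (cong (_* φ a) (edge-indicator e a)) (*-distribʳ-+ (φ a) (pt x a) _))) ⟩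
    ∑ (λ a → pt x a * φ a + pt (x ⊕ u) a * φ a)              ≡⟨ ∑-+ _ _ ⟩
    ∑ (λ a → pt x a * φ a) + ∑ (λ a → pt (x ⊕ u) a * φ a)    ≡⟨ cong₂ _+_ (∑-pt* x φ) (∑-pt* (x ⊕ u) φ) ⟩
    φ x + φ (x ⊕ u)                                          ∎
    where
    open ≡-Reasoning
    rearrange : ∀ a b c → a * b * c ≡ a * c * b
    rearrange = solve-∀

  endpoint : ∀ {u} → U u ≡ true → ∃ λ x → Edge x u
  endpoint {u} p with ∑≢0⇒∃ (λ a → α a * α (a ⊕ u)) (λ q → 1+n≢0 (trans (sym (rep≡2 p)) q))
  ... | x , fx = x , 𝟙≢0⇒ _ (λ q → fx (cong (_* α (x ⊕ u)) q))
                   , 𝟙≢0⇒ _ (λ q → fx (trans (cong (α x *_) q) (*-zeroʳ (α x)))) , p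

  edge-between : ∀ {x y} → A x ≡ true → A y ≡ true → U (x ⊕ y) ≡ true → Edge x (x ⊕ y)
  edge-between {x} {y} p q s =
    p , trans (cong A (xor-solve (x ∷ y ∷ []) (x₀ ⊞ (x₀ ⊞ x₁)) x₁ refl)) q , s

  -- Packing modulo an edge sum

  Packed : V r → V r → Subset₂ r → Set
  Packed x u Y = (∀ w → Y w ≡ true → A (w ⊕ x) ≡ false × A ((w ⊕ u) ⊕ x) ≡ false)
               × (∀ w → Y w ≡ true → Y (w ⊕ u) ≡ false)

  module Packing {x u} (e : Edge x u) (Y : Subset₂ r) (packed : Packed x u Y) where

    η : V r → ℕ
    η = χ Y

    f a y ε : V r → ℕ
    f w = α (w ⊕ x)
    a w = f w + f (w ⊕ u)
    y w = η w + η (w ⊕ u)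
    ε w = pt x (w ⊕ x) + pt (x ⊕ u) (w ⊕ x)

    a≤ : ∀ w → a w ≤ 1 + ε w
    a≤ w = subst (λ t → a w ≤ 1 + t)
      (trans (cong (λ t → α (w ⊕ x) * α t) (xor-solve (w ∷ u ∷ x ∷ []) ((x₀ ⊞ x₁) ⊞ x₂) ((x₀ ⊞ x₂) ⊞ x₁) refl))
             (edge-indicator e (w ⊕ x)))
      (bits (A (w ⊕ x)) (A ((w ⊕ u) ⊕ x)))
      where
      bits : ∀ b c → 𝟙 b + 𝟙 c ≤ 1 + 𝟙 b * 𝟙 c
      bits true  true  = ≤-refl
      bits true  false = ≤-refl
      bits false true  = ≤-refl
      bits false false = z≤n

    y≤1 : ∀ w → y w ≤ 1
    y≤1 w with Y w in p
    ... | true rewrite proj₂ packed w p = ≤-refl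
    ... | false = 𝟙≤1 (Y (w ⊕ u))

    exclusive : ∀ w → y w ≡ 0 ⊎ a w ≡ 0
    exclusive w with Y w in p
    ... | true rewrite proj₁ (proj₁ packed w p) | proj₂ (proj₁ packed w p) = inj₂ refl
    ... | false with Y (w ⊕ u) in q
    ... | false = inj₁ refl
    ... | true with proj₁ packed (w ⊕ u) q
    ... | s , t rewrite trans (cong (λ v → A (v ⊕ x)) (sym (⊕-cancelʳ w u))) t | s = inj₂ refl

    ∑-fold : ∀ g → ∑ (λ w → g w + g (w ⊕ u)) ≡ 2 * ∑ g
    ∑-fold g = trans (∑-+ g (λ w → g (w ⊕ u))) (trans (cong (∑ g +_) (∑-shift g u)) (double (∑ g)))
      where
      double : ∀ a → a + a ≡ 2 * a
      double = solve-∀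

    ∑a : ∑ a ≡ 2 * n
    ∑a = trans (∑-fold f) (cong (2 *_) (∑-shift α x))

    ∑ε : ∑ ε ≡ 2
    ∑ε = trans (∑-+ _ _) (cong₂ _+_ (trans (∑-shift (pt x) x) (∑-pt x)) (trans (∑-shift (pt (x ⊕ u)) x) (∑-pt (x ⊕ u))))

    ∑1 : ∑ {r} (λ _ → 1) ≡ 2 * M
    ∑1 = trans (∑-const r 1) (trans (*-identityʳ (2 ^ r)) 2^r≡2M)

    -- Modulo `u` the sets `Y` and `A + x` are disjoint among `M` classes; `Y` maps injectively, and
    -- `A + x` loses one class to the collision of its two ends.
    packing-size : ∑ η + n ≤ M + 1
    packing-size = *-cancelˡ-≤ 2 (subst₂ _≤_ lhs rhs (∑-mono pointwise))
      where
      pointwise : ∀ w → y w + a w ≤ 1 + ε w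
      pointwise w with exclusive w
      ... | inj₁ p rewrite p = a≤ w
      ... | inj₂ p rewrite p | +-identityʳ (y w) = ≤-trans (y≤1 w) (m≤m+n 1 _)
      lhs : ∑ (λ w → y w + a w) ≡ 2 * (∑ η + n)
      lhs = trans (∑-+ y a) (trans (cong₂ _+_ (∑-fold η) ∑a) (sym (*-distribˡ-+ 2 (∑ η) n)))
      rhs : ∑ (λ w → 1 + ε w) ≡ 2 * (M + 1)
      rhs = trans (∑-+ (λ _ → 1) ε) (trans (cong₂ _+_ ∑1 ∑ε) (sym (*-distribˡ-+ 2 M 1)))

    -- Inclusion-exclusion modulo `u`: `A + x` and its shift by `z` fill about `n` of the `M`
    -- classes each, both avoid the classes common to `Y` and its shift, and `rep z + rep (z ⊕ u)`
    -- measures their overlap. The 2 accounts for the two colliding classes.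
    packing-corr : ∀ z → corr η η z + corr η η (z ⊕ u) + 2 * n ≤ M + (rep z + rep (z ⊕ u)) + 2
    packing-corr z = *-cancelˡ-≤ 2 (subst₂ _≤_ lhs rhs (∑-mono pointwise))
      where
      pointwise : ∀ w → y w * y (w ⊕ z) + (a w + a (w ⊕ z)) ≤ 1 + a w * a (w ⊕ z) + (ε w + ε (w ⊕ z))
      pointwise w = packing-pointwise (a w) (a (w ⊕ z)) (y w) (y (w ⊕ z)) (ε w) (ε (w ⊕ z))
        (a≤ w) (a≤ (w ⊕ z)) (y≤1 w) (y≤1 (w ⊕ z)) (exclusive w) (exclusive (w ⊕ z))
      twice : ∀ {g s} → ∑ g ≡ s → ∑ (λ w → g w + g (w ⊕ z)) ≡ s + s
      twice {g} p = trans (∑-+ g (λ w → g (w ⊕ z))) (cong₂ _+_ p (trans (∑-shift g z) p))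
      lhs : ∑ (λ w → y w * y (w ⊕ z) + (a w + a (w ⊕ z))) ≡ 2 * (corr η η z + corr η η (z ⊕ u) + 2 * n)
      lhs = trans (∑-+ _ _) (trans (cong₂ _+_ (corr-fold η u z) (twice {a} ∑a)) (arith (corr η η z + corr η η (z ⊕ u)) n))
        where
        arith : ∀ c n → 2 * c + (2 * n + 2 * n) ≡ 2 * (c + 2 * n)
        arith = solve-∀
      rhs : ∑ (λ w → 1 + a w * a (w ⊕ z) + (ε w + ε (w ⊕ z))) ≡ 2 * (M + (rep z + rep (z ⊕ u)) + 2)
      rhs = trans (∑-+ _ _) (trans (cong₂ _+_ (trans (∑-+ _ _) (cong₂ _+_ ∑1 (trans (corr-fold f u z)
              (cong (2 *_) (cong₂ _+_ (corr-shift α α x z) (corr-shift α α x (z ⊕ u))))))) (twice {ε} ∑ε))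
              (arith M (rep z + rep (z ⊕ u))))
        where
        arith : ∀ M c → 2 * M + 2 * c + 4 ≡ 2 * (M + c + 2)
        arith = solve-∀

  -- `packing-corr` at `v` with `Y` empty: the overlap would only be `2 + 2`, which is too small for
  -- sets filling more than half of the classes.
  sum-free : ∀ {u v} → U u ≡ true → U v ≡ true → U (u ⊕ v) ≡ true → ⊥
  sum-free {u} {v} p q s = <-irrefl refl (<-≤-trans large (begin
    18 * n          ≡⟨ nine n ⟩
    9 * (2 * n)     ≤⟨ *-monoʳ-≤ 9 small ⟩
    9 * (M + 6)     ≡⟨ *-distribˡ-+ 9 M 6 ⟩
    9 * M + 54      ≤⟨ +-monoˡ-≤ 54 (*-monoˡ-≤ M {9} {11} (m≤m+n 9 2)) ⟩
    11 * M + 54     ∎))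
    where
    open ≤-Reasoning
    nine : ∀ n → 18 * n ≡ 9 * (2 * n)
    nine = solve-∀
    open Packing (proj₂ (endpoint p)) (λ _ → false) ((λ _ ()) , (λ _ ()))
    small : 2 * n ≤ M + 6
    small = begin
      2 * n                                              ≤⟨ m≤n+m (2 * n) (corr η η v + corr η η (v ⊕ u)) ⟩
      corr η η v + corr η η (v ⊕ u) + 2 * n              ≤⟨ packing-corr v ⟩
      M + (rep v + rep (v ⊕ u)) + 2                      ≡⟨ cong₂ (λ i j → M + (i + j) + 2) (rep≡2 q)
                                                              (trans (cong rep (⊕-comm v u)) (rep≡2 s)) ⟩
      M + 4 + 2                                          ≡⟨ +-assoc M 4 2 ⟩
      M + 6                                              ∎

  module Away {x u} (e : Edge x u) where

    Y Z : Subset₂ r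
    Y w = U w ∧ (not (A (w ⊕ x)) ∧ not (A ((w ⊕ u) ⊕ x)))
    Z w = U w ∧ not (not (A (w ⊕ x)) ∧ not (A ((w ⊕ u) ⊕ x)))

    not-true : ∀ {b} → not b ≡ true → b ≡ false
    not-true {false} p = refl

    Y-packed : Packed x u Y
    proj₁ Y-packed w p = not-true (∧-trueˡ {not (A (w ⊕ x))} (∧-trueʳ {U w} p))
                       , not-true (∧-trueʳ {not (A (w ⊕ x))} (∧-trueʳ {U w} p))
    proj₂ Y-packed w p with U (w ⊕ u) in q
    ... | false = refl
    ... | true  = ⊥-elim (sum-free (∧-trueˡ {U w} p) (proj₂ (proj₂ e)) q)

    open Packing e Y Y-packed public

    ν : V r → ℕ
    ν = χ Z

    split : ∀ w → μ w ≡ η w + ν w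
    split w with U w | not (A (w ⊕ x)) ∧ not (A ((w ⊕ u) ⊕ x))
    ... | true  | true  = refl
    ... | true  | false = refl
    ... | false | _     = refl

    -- Every member of `Z` is the sum of an edge at `x` or `x ⊕ u`, and `u` itself is counted in
    -- both degrees, whence the 1.
    ∑ν : ∑ ν + 1 ≤ deg x + deg (x ⊕ u)
    ∑ν = subst₂ _≤_ (trans (∑-+ ν (pt u)) (cong (∑ ν +_) (∑-pt u))) (∑-+ _ _) (∑-mono pointwise)
      where
      bits : ∀ a b c → 𝟙 (a ∧ not (not b ∧ not c)) ≤ 𝟙 a * 𝟙 b + 𝟙 a * 𝟙 c
      bits false b c = z≤n
      bits true true c = s≤s z≤n
      bits true false true = ≤-refl
      bits true false false = z≤n
      flip : ∀ w → (w ⊕ u) ⊕ x ≡ w ⊕ (x ⊕ u)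
      flip w = xor-solve (w ∷ u ∷ x ∷ []) ((x₀ ⊞ x₁) ⊞ x₂) (x₀ ⊞ (x₂ ⊞ x₁)) refl
      pointwise : ∀ w → ν w + pt u w ≤ μ w * α (w ⊕ x) + μ w * α (w ⊕ (x ⊕ u))
      pointwise w with w ≟ⱽ u
      ... | no p rewrite pt-distinct p | +-identityʳ (ν w) =
        subst (λ t → ν w ≤ μ w * α (w ⊕ x) + μ w * α t) (flip w) (bits (U w) (A (w ⊕ x)) (A ((w ⊕ u) ⊕ x)))
      ... | yes refl = begin
        ν u + pt u u                                  ≤⟨ +-mono-≤ (𝟙≤1 (Z u)) (≤-reflexive (pt-same u)) ⟩
        2                                             ≡⟨ cong₂ _+_ (sym (cong₂ (λ b c → 𝟙 b * 𝟙 c) (proj₂ (proj₂ e))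
                                                           (trans (cong A (⊕-comm u x)) (proj₁ (proj₂ e)))))
                                                           (sym (cong₂ (λ b c → 𝟙 b * 𝟙 c) (proj₂ (proj₂ e))
                                                           (trans (cong A (xor-solve (u ∷ x ∷ []) (x₀ ⊞ (x₁ ⊞ x₀)) x₁ refl)) (proj₁ e)))) ⟩
        μ u * α (u ⊕ x) + μ u * α (u ⊕ (x ⊕ u))       ∎
        where open ≤-Reasoning

    -- The 1 lost to the collision in `packing-size` is regained from the double count of `u` in
    -- `∑ν`.
    degree-bound : m + n ≤ M + (deg x + deg (x ⊕ u))
    degree-bound = begin
      m + n                       ≡⟨ cong (_+ n) (trans (∑-cong split) (∑-+ η ν)) ⟩
      ∑ η + ∑ ν + n               ≡⟨ swap₃ (∑ η) (∑ ν) n ⟩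
      ∑ η + n + ∑ ν               ≤⟨ +-monoˡ-≤ (∑ ν) packing-size ⟩
      M + 1 + ∑ ν                 ≡⟨ swap₃′ M (∑ ν) ⟩
      M + (∑ ν + 1)               ≤⟨ +-monoʳ-≤ M ∑ν ⟩
      M + (deg x + deg (x ⊕ u))   ∎
      where
      open ≤-Reasoning
      swap₃ : ∀ a b c → a + b + c ≡ a + c + b
      swap₃ = solve-∀
      swap₃′ : ∀ a b → a + 1 + b ≡ a + (b + 1)
      swap₃′ = solve-∀

    corr-μ≤ : ∀ z → corr μ μ z ≤ corr η η z + 2 * ∑ ν
    corr-μ≤ z = begin
      corr μ μ z                                                  ≤⟨ ∑-mono pointwise ⟩
      ∑ (λ w → η w * η (w ⊕ z) + (ν w + ν (w ⊕ z)))               ≡⟨ trans (∑-+ _ _) (cong (corr η η z +_)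
                                                                       (trans (∑-+ ν _) (cong (∑ ν +_) (∑-shift ν z)))) ⟩
      corr η η z + (∑ ν + ∑ ν)                                    ≡⟨ cong (λ t → corr η η z + (∑ ν + t)) (sym (+-identityʳ (∑ ν))) ⟩
      corr η η z + 2 * ∑ ν                                        ∎
      where
      open ≤-Reasoning
      bits : ∀ a b c d → a + b ≤ 1 → c + d ≤ 1 → (a + b) * (c + d) ≤ a * c + (b + d)
      bits zero b c d p q = ≤-trans (*-monoʳ-≤ b q) (≤-trans (≤-reflexive (*-identityʳ b)) (m≤m+n b d))
      bits (suc zero) zero zero d p q = ≤-reflexive (trans (+-identityʳ d) refl)
      bits (suc zero) zero (suc zero) zero p q = ≤-refl
      bits (suc zero) zero (suc zero) (suc d) p (s≤s ())
      bits (suc zero) zero (suc (suc c)) d p (s≤s ())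
      bits (suc zero) (suc b) c d (s≤s ()) q
      bits (suc (suc a)) b c d (s≤s ()) q
      pointwise : ∀ w → μ w * μ (w ⊕ z) ≤ η w * η (w ⊕ z) + (ν w + ν (w ⊕ z))
      pointwise w rewrite split w | split (w ⊕ z) = bits (η w) (ν w) (η (w ⊕ z)) (ν (w ⊕ z))
        (subst (_≤ 1) (split w) (𝟙≤1 (U w))) (subst (_≤ 1) (split (w ⊕ z)) (𝟙≤1 (U (w ⊕ z))))

    -- The 8 is made up as follows: `Z` has at most 2 members and changes the correlation by at most
    -- 4, `rep v` is 2, and the colliding classes cost 2.
    rep-lower : deg x + deg (x ⊕ u) ≤ 3 → ∀ {v} → U v ≡ true → corr μ μ (v ⊕ u) + 2 * n ≤ M + rep (v ⊕ u) + 8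
    rep-lower d {v} q = begin
      corr μ μ z + 2 * n                         ≤⟨ +-monoˡ-≤ (2 * n) (corr-μ≤ z) ⟩
      corr η η z + 2 * ∑ ν + 2 * n               ≤⟨ +-monoˡ-≤ (2 * n) (+-monoʳ-≤ (corr η η z) (*-monoʳ-≤ 2
                                                      (+-cancelʳ-≤ 1 (∑ ν) 2 (≤-trans ∑ν d)))) ⟩
      corr η η z + 4 + 2 * n                     ≡⟨ swap₃ (corr η η z) (2 * n) ⟩
      corr η η z + 2 * n + 4                     ≤⟨ +-monoˡ-≤ 4 (+-monoˡ-≤ (2 * n) (m≤n+m (corr η η z) (corr η η v))) ⟩
      corr η η v + corr η η z + 2 * n + 4        ≤⟨ +-monoˡ-≤ 4 (packing-corr v) ⟩
      M + (rep v + rep z) + 2 + 4                ≡⟨ cong (λ t → M + (t + rep z) + 2 + 4) (rep≡2 q) ⟩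
      M + (2 + rep z) + 2 + 4                    ≡⟨ collect M (rep z) ⟩
      M + rep z + 8                              ∎
      where
      open ≤-Reasoning
      z = v ⊕ u
      swap₃ : ∀ a b → a + 4 + b ≡ a + b + 4
      swap₃ = solve-∀
      collect : ∀ a b → a + (2 + b) + 2 + 4 ≡ a + b + 8
      collect = solve-∀

  open Away public using (degree-bound; rep-lower)

  -- Matchings and their maximal extensions

  tdeg : Subset₂ r → V r → ℕ
  tdeg R = corr (χ R) α

  -- A set of edges is stored as the set of their sums; `tdeg` then counts the chosen edges at a
  -- vertex.
  Matching : Subset₂ r → Set
  Matching R = (∀ {u} → R u ≡ true → U u ≡ true) × (∀ {a} → A a ≡ true → tdeg R a ≤ 1)

  Maximal : Subset₂ r → Set
  Maximal R = ∀ {x u} → Edge x u → 1 ≤ tdeg R x + tdeg R (x ⊕ u)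

  ∑χ≤ : ∀ (X : Subset₂ r) → ∑ (χ X) ≤ 2 ^ r
  ∑χ≤ X = ≤-trans (∑-mono (λ x → 𝟙≤1 (X x))) (≤-reflexive (trans (∑-const r 1) (*-identityʳ _)))

  insert : V r → Subset₂ r → Subset₂ r
  insert u R w = R w ∨ does (w ≟ⱽ u)

  χ-insert : ∀ {u} R → R u ≡ false → ∀ w → χ (insert u R) w ≡ χ R w + pt u w
  χ-insert {u} R p w with w ≟ⱽ u
  ... | yes refl rewrite p | pt-same w = refl
  ... | no q rewrite ∨-identityʳ (R w) | pt-distinct q = sym (+-identityʳ _)

  tdeg-insert : ∀ {u} R → R u ≡ false → ∀ a → tdeg (insert u R) a ≡ tdeg R a + α (u ⊕ a)
  tdeg-insert {u} R p a = trans
    (∑-cong (λ w → trans (cong (_* α (w ⊕ a)) (χ-insert R p w)) (*-distribʳ-+ (α (w ⊕ a)) (χ R w) (pt u w))))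
    (trans (∑-+ _ _) (cong (tdeg R a +_) (∑-pt* u (λ w → α (w ⊕ a)))))

  1≤tdeg : ∀ {x u} R → R u ≡ true → A (x ⊕ u) ≡ true → 1 ≤ tdeg R x
  1≤tdeg {x} {u} R p q = subst (_≤ tdeg R x) (cong₂ (λ b c → 𝟙 b * 𝟙 c) p (trans (cong A (⊕-comm u x)) q))
    (term≤∑ (λ w → χ R w * α (w ⊕ x)) u)

  module _ {R u x} (mt : Matching R) (e : Edge x u) (free : tdeg R x + tdeg R (x ⊕ u) ≡ 0) where

    free-new : R u ≡ false
    free-new with R u in p
    ... | false = refl
    ... | true  = ⊥-elim (<⇒≢ (≤-trans (1≤tdeg R p (proj₁ (proj₂ e))) (m≤m+n _ _)) (sym free))

    insert-matching : Matching (insert u R)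
    proj₁ insert-matching {w} p with R w in q | w ≟ⱽ u
    ... | true  | _        = proj₁ mt q
    ... | false | yes refl = proj₂ (proj₂ e)
    proj₂ insert-matching {a} p rewrite tdeg-insert R free-new a with A (u ⊕ a) in q
    ... | false = ≤-trans (≤-reflexive (+-identityʳ _)) (proj₂ mt p)
    ... | true with edge-unique e p (trans (cong A (⊕-comm a u)) q)
    ... | inj₁ refl = ≤-reflexive (cong (_+ 1) (m+n≡0⇒m≡0 (tdeg R x) free))
    ... | inj₂ refl = ≤-reflexive (cong (_+ 1) (m+n≡0⇒n≡0 (tdeg R x) free))

    ∑-insert : ∑ (χ (insert u R)) ≡ suc (∑ (χ R))
    ∑-insert = trans (∑-cong (χ-insert R free-new)) (trans (∑-+ _ _) (trans (cong (∑ (χ R) +_) (∑-pt u)) (+-comm _ 1)))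

  extend : ∀ fuel R → Matching R → 2 ^ r ≤ ∑ (χ R) + fuel →
           ∃ λ R′ → Matching R′ × Maximal R′ × ∑ (χ R) ≤ ∑ (χ R′)
  extend fuel R mt enough with ∑ g ≟ 0
    where
    -- By `edge-sum` the correlation is the number of chosen edges at the two ends of `u`, so `g`
    -- marks the edges that can still be added.
    g : V r → ℕ
    g u = μ u * 𝟙 (corr (λ a → α a * tdeg R a) α u ≡ᵇ 0)
  ... | yes none = R , mt , maximal , ≤-refl
    where
    maximal : Maximal R
    maximal {x} {u} e with tdeg R x + tdeg R (x ⊕ u) in q
    ... | suc _ = s≤s z≤n
    ... | zero  = ⊥-elim (1+n≢0 (trans (sym (cong₂ (λ b c → 𝟙 b * 𝟙 c) (proj₂ (proj₂ e))
                    (cong (_≡ᵇ 0) (trans (edge-sum e (tdeg R)) q)))) (∑≡0⇒ _ none u)))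
  ... | no some with ∑≢0⇒∃ _ some
  ... | u , gu with endpoint (𝟙≢0⇒ (U u) (λ q → gu (cong (_* 𝟙 (corr (λ a → α a * tdeg R a) α u ≡ᵇ 0)) q)))
  ... | x , e = grow fuel enough
    where
    free : tdeg R x + tdeg R (x ⊕ u) ≡ 0
    free = trans (sym (edge-sum e (tdeg R))) (≡ᵇ⇒≡ _ 0 (subst T (sym
      (𝟙≢0⇒ (corr (λ a → α a * tdeg R a) α u ≡ᵇ 0) (λ q → gu (trans (cong (μ u *_) q) (*-zeroʳ (μ u)))))) tt))
    grow : ∀ fuel → 2 ^ r ≤ ∑ (χ R) + fuel → ∃ λ R′ → Matching R′ × Maximal R′ × ∑ (χ R) ≤ ∑ (χ R′)
    grow zero enough = ⊥-elim (<-irrefl refl (<-≤-trans (s≤s (≤-trans enough (≤-reflexive (+-identityʳ _))))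
      (subst (_≤ 2 ^ r) (∑-insert mt e free) (∑χ≤ (insert u R)))))
    grow (suc fuel) enough with extend fuel (insert u R) (insert-matching mt e free)
      (subst (λ t → 2 ^ r ≤ t + fuel) (sym (∑-insert mt e free)) (subst (2 ^ r ≤_) (+-suc _ fuel) enough))
    ... | R′ , mt′ , max , le = R′ , mt′ , max ,
          ≤-trans (n≤1+n _) (subst (_≤ ∑ (χ R′)) (∑-insert mt e free) le)

  extend-to-maximal : ∀ R → Matching R → ∃ λ R′ → Matching R′ × Maximal R′ × ∑ (χ R) ≤ ∑ (χ R′)
  extend-to-maximal R mt = extend (2 ^ r) R mt (m≤n+m _ _)

  ∑α*deg : ∑ (λ a → α a * deg a) ≡ 2 * m
  ∑α*deg = trans (sym (corr-swap μ α α)) (trans (∑-cong pointwise) (∑-*ˡ 2 μ))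
    where
    pointwise : ∀ u → μ u * rep u ≡ 2 * μ u
    pointwise u with U u in p
    ... | true  = trans (+-identityʳ _) (rep≡2 p)
    ... | false = refl

  -- Adjacency and the choice of neighbours

  Adj : V r → V r → Set
  Adj x y = A x ≡ true × A y ≡ true × U (x ⊕ y) ≡ true

  N : V r → Subset₂ r
  N x a = A a ∧ U (x ⊕ a)

  adj-sym : ∀ {x y} → Adj x y → Adj y x
  adj-sym {x} {y} (p , q , s) = q , p , trans (cong U (⊕-comm y x)) s

  adj⇒edge : ∀ {x y} → Adj x y → Edge x (x ⊕ y)
  adj⇒edge (p , q , s) = edge-between p q s

  edge⇒adj : ∀ {x u} → Edge x u → Adj x (x ⊕ u)
  edge⇒adj {x} {u} (p , q , s) = p , q , trans (cong U (xor-solve (x ∷ u ∷ []) (x₀ ⊞ (x₀ ⊞ x₁)) x₁ refl)) s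

  adj⇒≢ : ∀ {x y} → Adj x y → x ≢ y
  adj⇒≢ {x} (_ , _ , s) refl = U⇒≢𝟎 s (⊕-self x)

  adj-unique : ∀ {x y b} → Adj x y → A b ≡ true → A (b ⊕ (x ⊕ y)) ≡ true → b ≡ x ⊎ b ≡ y
  adj-unique {x} {y} {b} e p q with edge-unique (adj⇒edge e) p q
  ... | inj₁ t = inj₁ t
  ... | inj₂ t = inj₂ (trans t (xor-solve (x ∷ y ∷ []) (x₀ ⊞ (x₀ ⊞ x₁)) x₁ refl))

  -- The three sums along a triangle add up to `𝟎`, so one of them is the sum of the other two.
  triangle-free : ∀ {x y z} → Adj x y → Adj y z → U (x ⊕ z) ≡ true → ⊥
  triangle-free {x} {y} {z} (_ , _ , p) (_ , _ , q) s =
    sum-free p q (trans (cong U (xor-solve (x ∷ y ∷ z ∷ []) ((x₀ ⊞ x₁) ⊞ (x₁ ⊞ x₂)) (x₀ ⊞ x₂) refl)) s)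

  neighbour-avoiding₂ : ∀ {x} → A x ≡ true → 3 ≤ deg x → ∀ p q → ∃ λ y → Adj x y × y ≢ p × y ≢ q
  neighbour-avoiding₂ {x} px 3≤d p q with ∑χ-inhabited ((Nₓ ∖ (p ⊕ x)) ∖ (q ⊕ x))
    (+-cancelʳ-≤ 2 1 _ (≤-trans 3≤d (≤-trans deg≤ (≤-trans (∑χ≤∑χ∖+1 Nₓ (p ⊕ x)) (≤-trans
      (+-monoˡ-≤ 1 (∑χ≤∑χ∖+1 (Nₓ ∖ (p ⊕ x)) (q ⊕ x))) (≤-reflexive (+-assoc _ 1 1)))))))
    where
    Nₓ : Subset₂ r
    Nₓ w = U w ∧ A (w ⊕ x)
    deg≤ : deg x ≤ ∑ (χ Nₓ)
    deg≤ = ∑-mono (λ w → 𝟙-∧ (U w) (A (w ⊕ x)))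
  ... | w , t = w ⊕ x
    , (px , ∧-trueʳ {U w} in-N , trans (cong U (xor-solve (x ∷ w ∷ []) (x₀ ⊞ (x₁ ⊞ x₀)) x₁ refl)) (∧-trueˡ {U w} in-N))
    , (λ s → ∖-≢ Nₓ in-N∖p (trans (sym (⊕-cancelʳ w x)) (cong (_⊕ x) s)))
    , (λ s → ∖-≢ (Nₓ ∖ (p ⊕ x)) t (trans (sym (⊕-cancelʳ w x)) (cong (_⊕ x) s)))
    where
    Nₓ : Subset₂ r
    Nₓ w = U w ∧ A (w ⊕ x)
    in-N∖p : (Nₓ ∖ (p ⊕ x)) w ≡ true
    in-N∖p = ∖-⊆ (Nₓ ∖ (p ⊕ x)) t
    in-N : Nₓ w ≡ true
    in-N = ∖-⊆ Nₓ in-N∖p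

  -- An edge pq excludes only one of its ends, since the graph has no triangles.
  neighbour-avoiding-edge : ∀ {x p q} → A x ≡ true → 3 ≤ deg x → Adj p q → ∀ t →
                            ∃ λ y → Adj x y × y ≢ p × y ≢ q × y ≢ t
  neighbour-avoiding-edge {x} {p} {q} px 3≤d e t with U (x ⊕ p) in s
  ... | true with neighbour-avoiding₂ px 3≤d p t
  ...   | y , adj , y≢p , y≢t = y , adj , y≢p ,
            (λ { refl → triangle-free (px , proj₁ e , s) e (proj₂ (proj₂ adj)) }) , y≢t
  neighbour-avoiding-edge {x} {p} {q} px 3≤d e t | false with neighbour-avoiding₂ px 3≤d q t
  ...   | y , adj , y≢q , y≢t = y , adj ,
            (λ { refl → true≢false (trans (sym (proj₂ (proj₂ adj))) s) }) , y≢q , y≢t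

  not-end : ∀ {x y c} → Adj x y → A c ≡ true → c ≢ x → c ≢ y → α ((x ⊕ y) ⊕ c) ≡ 0
  not-end {x} {y} {c} e p c≢x c≢y = χ-false A (≢true⇒false λ q →
    case adj-unique e p (trans (cong A (⊕-comm c (x ⊕ y))) q) of λ { (inj₁ t) → c≢x t ; (inj₂ t) → c≢y t })

  -- Two stars cannot cover `A`

  module TwoCentres {x y} (px : A x ≡ true) (py : A y ≡ true) (x≢y : x ≢ y)
                    (cover : ∀ {a} → A a ≡ true → a ≢ x → a ≢ y → Adj x a ⊎ Adj y a) where

    s : V r
    s = x ⊕ y

    A° Ex Ey : Subset₂ r
    A° = (A ∖ x) ∖ y
    Ex = N x ∖ y
    Ey = N y ∖ x

    A°⇒ : ∀ {a} → A° a ≡ true → A a ≡ true × a ≢ x × a ≢ y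
    A°⇒ p = ∖-⊆ A (∖-⊆ (A ∖ x) p) , ∖-≢ A (∖-⊆ (A ∖ x) p) , ∖-≢ (A ∖ x) p

    Ey⇒ : ∀ {a} → Ey a ≡ true → Adj y a × a ≢ x
    Ey⇒ {a} p = (py , ∧-trueˡ {A a} (∖-⊆ (N y) p) , ∧-trueʳ {A a} (∖-⊆ (N y) p)) , ∖-≢ (N y) p

    Ey⊆A° : ∀ {a} → Ey a ≡ true → A° a ≡ true
    Ey⊆A° p = let (e , a≢x) = Ey⇒ p in
      ∖-intro (A ∖ x) (∖-intro A (proj₁ (proj₂ e)) a≢x) (λ t → adj⇒≢ e (sym t))

    -- Otherwise `e₂ ⊕ e` would be a second representation of `x ⊕ e₁`, or `e₁ ⊕ e` one of `y ⊕ e₂`.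
    no-relation : ∀ {e₁ e₂ e} → Adj x e₁ → e₁ ≢ y → Adj y e₂ → e₂ ≢ x → A° e ≡ true →
                  ((e₁ ⊕ e₂) ⊕ e ≢ x) × ((e₁ ⊕ e₂) ⊕ e ≢ y)
    no-relation {e₁} {e₂} {e} adj₁ e₁≢y adj₂ e₂≢x p = with-x , with-y
      where
      e∈ = A°⇒ p
      A-cong : ∀ {a} → a ≡ e → A a ≡ true
      A-cong refl = proj₁ e∈
      with-x : (e₁ ⊕ e₂) ⊕ e ≢ x
      with-x t with adj-unique adj₁ (proj₁ (proj₂ adj₂)) (A-cong (trans (cong (λ v → e₂ ⊕ (v ⊕ e₁)) (sym t))
                      (xor-solve (e₁ ∷ e₂ ∷ e ∷ []) (x₁ ⊞ (((x₀ ⊞ x₁) ⊞ x₂) ⊞ x₀)) x₂ refl)))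
      ... | inj₁ u    = e₂≢x u
      ... | inj₂ refl = proj₁ (proj₂ e∈) (trans (xor-solve (e₁ ∷ e ∷ []) x₁ ((x₀ ⊞ x₀) ⊞ x₁) refl) t)
      with-y : (e₁ ⊕ e₂) ⊕ e ≢ y
      with-y t with adj-unique adj₂ (proj₁ (proj₂ adj₁)) (A-cong (trans (cong (λ v → e₁ ⊕ (v ⊕ e₂)) (sym t))
                      (xor-solve (e₁ ∷ e₂ ∷ e ∷ []) (x₀ ⊞ (((x₀ ⊞ x₁) ⊞ x₂) ⊞ x₁)) x₂ refl)))
      ... | inj₁ u    = e₁≢y u
      ... | inj₂ refl = proj₂ (proj₂ e∈) (trans (xor-solve (e₁ ∷ e ∷ []) x₁ ((x₀ ⊞ x₀) ⊞ x₁) refl) t)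

    -- If `w` is adjacent to `x`, then `y` and `w ⊕ s` also have the sum `x ⊕ w`, contrary to
    -- uniqueness; likewise with `x` and `y` exchanged.
    A°-self : ∀ w → A° w ≡ true → A° (w ⊕ s) ≡ true → ⊥
    A°-self w p q with A°⇒ p | A°⇒ q
    ... | pw , w≢x , w≢y | pws , _ , _ = go (cover pw w≢x w≢y)
      where
      w⊕s≢w : w ⊕ s ≢ w
      w⊕s≢w t = x≢y (⊕≡𝟎⇒≡ (trans (xor-solve (w ∷ s ∷ []) x₁ (x₀ ⊞ (x₀ ⊞ x₁)) refl) (trans (cong (w ⊕_) t) (⊕-self w))))
      go : Adj x w ⊎ Adj y w → ⊥
      go (inj₁ e) with adj-unique e pws (trans (cong A
        (xor-solve (w ∷ x ∷ y ∷ []) ((x₀ ⊞ (x₁ ⊞ x₂)) ⊞ (x₁ ⊞ x₀)) x₂ refl)) py)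
      ... | inj₁ t = w≢y (trans (xor-solve (w ∷ x ∷ y ∷ []) x₀ ((x₀ ⊞ (x₁ ⊞ x₂)) ⊞ (x₁ ⊞ x₂)) refl)
                       (trans (cong (_⊕ s) t) (xor-solve (x ∷ y ∷ []) (x₀ ⊞ (x₀ ⊞ x₁)) x₁ refl)))
      ... | inj₂ t = w⊕s≢w t
      go (inj₂ e) with adj-unique e pws (trans (cong A
        (xor-solve (w ∷ x ∷ y ∷ []) ((x₀ ⊞ (x₁ ⊞ x₂)) ⊞ (x₂ ⊞ x₀)) x₁ refl)) px)
      ... | inj₁ t = w≢x (trans (xor-solve (w ∷ x ∷ y ∷ []) x₀ ((x₀ ⊞ (x₁ ⊞ x₂)) ⊞ (x₁ ⊞ x₂)) refl)
                       (trans (cong (_⊕ s) t) (xor-solve (x ∷ y ∷ []) (x₁ ⊞ (x₀ ⊞ x₁)) x₀ refl)))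
      ... | inj₂ t = w⊕s≢w t

    n≤∑A°+2 : n ≤ ∑ (χ A°) + 2
    n≤∑A°+2 = ≤-trans (∑χ≤∑χ∖+1 A x) (≤-trans (+-monoˡ-≤ 1 (∑χ≤∑χ∖+1 (A ∖ x) y)) (≤-reflexive (+-assoc _ 1 1)))

    -- Four disjoint translates of `A°` would give `n ≤ M / 2 + 2`, far below the assumed size.
    overfull : 2 * (2 * ∑ (χ A°)) ≤ 2 ^ r → ⊥
    overfull p = <-irrefl refl (<-≤-trans large (begin
      18 * n                       ≡⟨ id₁ n ⟩
      n * 2 * 9                    ≤⟨ *-monoˡ-≤ 9 (*-monoˡ-≤ 2 n≤∑A°+2) ⟩
      (∑ (χ A°) + 2) * 2 * 9       ≡⟨ id₂ (∑ (χ A°)) ⟩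
      2 * ∑ (χ A°) * 9 + 36        ≤⟨ +-mono-≤ (*-monoˡ-≤ 9 halved) (m≤m+n 36 18) ⟩
      M * 9 + 54                   ≤⟨ +-monoˡ-≤ 54 (≤-trans (*-monoʳ-≤ M (m≤m+n 9 2)) (≤-reflexive (*-comm M 11))) ⟩
      11 * M + 54                  ∎))
      where
      open ≤-Reasoning
      halved : 2 * ∑ (χ A°) ≤ M
      halved = *-cancelˡ-≤ 2 (subst (2 * (2 * ∑ (χ A°)) ≤_) 2^r≡2M p)
      id₁ : ∀ n → 18 * n ≡ n * 2 * 9
      id₁ = solve-∀
      id₂ : ∀ a → (a + 2) * 2 * 9 ≡ 2 * a * 9 + 36
      id₂ = solve-∀

    ∑A°≤ : ∑ (χ A°) ≤ ∑ (χ Ex) + ∑ (χ Ey)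
    ∑A°≤ = ≤-trans (∑-mono pointwise) (≤-reflexive (∑-+ _ _))
      where
      pointwise : ∀ a → χ A° a ≤ χ Ex a + χ Ey a
      pointwise a with A° a in p
      ... | false = z≤n
      ... | true with A°⇒ p
      ... | pa , a≢x , a≢y with cover pa a≢x a≢y
      ... | inj₁ e rewrite ∖-intro (N x) {a} {y} (cong₂ _∧_ pa (proj₂ (proj₂ e))) a≢y = m≤m+n 1 _
      ... | inj₂ e rewrite ∖-intro (N y) {a} {x} (cong₂ _∧_ pa (proj₂ (proj₂ e))) a≢x = m≤n+m 1 _

    module _ {e₁} (adj₁ : Adj x e₁) (e₁≢y : e₁ ≢ y) (Ex≤Ey : ∑ (χ Ex) ≤ ∑ (χ Ey)) where

      triple-in-star : ∀ {e e′} → A° e ≡ true → A° e′ ≡ true → ((e₁ ⊕ e) ⊕ e′ ≡ x) ⊎ ((e₁ ⊕ e) ⊕ e′ ≡ y) → Adj x e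
      triple-in-star {e} p p′ rel with cover (proj₁ (A°⇒ p)) (proj₁ (proj₂ (A°⇒ p))) (proj₂ (proj₂ (A°⇒ p)))
      ... | inj₁ adj = adj
      ... | inj₂ adj with no-relation adj₁ e₁≢y adj (proj₁ (proj₂ (A°⇒ p))) p′ | rel
      ... | no-x , _ | inj₁ t = ⊥-elim (no-x t)
      ... | _ , no-y | inj₂ t = ⊥-elim (no-y t)

      -- The relation makes both `e` and `e′` neighbours of `x`. Then `no-relation` keeps `A°` and
      -- the translates of `Ey` by `e ⊕ x` and `e′ ⊕ x` apart, even modulo `s`. As `Ey` is the
      -- larger star, `A°` with two copies of `Ey` weighs at least as much as two copies of `A°`.
      no-triple : ∀ {e e′} → A° e ≡ true → A° e′ ≡ true → ((e₁ ⊕ e) ⊕ e′ ≡ x) ⊎ ((e₁ ⊕ e) ⊕ e′ ≡ y) → ⊥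
      no-triple {e} {e′} p p′ rel = overfull (≤-trans (*-monoʳ-≤ 2 bound)
        (three-packing s A° (Ey[ e ]) (Ey[ e′ ]) A°-self (Ey-self e) (Ey-self e′) (apart p adj) (apart p′ adj′) both))
        where
        adj = triple-in-star p p′ rel
        adj′ : Adj x e′
        adj′ = triple-in-star p′ p (swap rel)
          where
          eq : (e₁ ⊕ e′) ⊕ e ≡ (e₁ ⊕ e) ⊕ e′
          eq = xor-solve (e₁ ∷ e ∷ e′ ∷ []) ((x₀ ⊞ x₂) ⊞ x₁) ((x₀ ⊞ x₁) ⊞ x₂) refl
          swap : ((e₁ ⊕ e) ⊕ e′ ≡ x) ⊎ ((e₁ ⊕ e) ⊕ e′ ≡ y) → ((e₁ ⊕ e′) ⊕ e ≡ x) ⊎ ((e₁ ⊕ e′) ⊕ e ≡ y)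
          swap (inj₁ t) = inj₁ (trans eq t)
          swap (inj₂ t) = inj₂ (trans eq t)
        Ey[_] : V r → Subset₂ r
        Ey[ c ] w = Ey (w ⊕ (c ⊕ x))
        ∑Ey[_] : ∀ c → ∑ (χ Ey[ c ]) ≡ ∑ (χ Ey)
        ∑Ey[ c ] = ∑-shift (χ Ey) (c ⊕ x)
        Ey-self : ∀ c w → Ey[ c ] w ≡ true → Ey[ c ] (w ⊕ s) ≡ true → ⊥
        Ey-self c w t t′ = A°-self (w ⊕ (c ⊕ x)) (Ey⊆A° t) (trans (cong A°
          (xor-solve (w ∷ c ∷ x ∷ y ∷ []) ((x₀ ⊞ (x₁ ⊞ x₂)) ⊞ (x₂ ⊞ x₃)) ((x₀ ⊞ (x₂ ⊞ x₃)) ⊞ (x₁ ⊞ x₂)) refl)) (Ey⊆A° t′))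
        apart : ∀ {c} → A° c ≡ true → Adj x c → ∀ w → A° w ≡ true →
                (Ey[ c ] w ≡ true → ⊥) × (Ey[ c ] (w ⊕ s) ≡ true → ⊥)
        apart {c} pc adj-c w pw =
            (λ t → let (a , ≢x) = Ey⇒ t in proj₁ (no-relation adj-c (proj₂ (proj₂ (A°⇒ pc))) a ≢x pw)
               (xor-solve (w ∷ c ∷ x ∷ []) ((x₁ ⊞ (x₀ ⊞ (x₁ ⊞ x₂))) ⊞ x₀) x₂ refl))
          , (λ t → let (a , ≢x) = Ey⇒ t in proj₂ (no-relation adj-c (proj₂ (proj₂ (A°⇒ pc))) a ≢x pw)
               (xor-solve (w ∷ c ∷ x ∷ y ∷ []) ((x₁ ⊞ ((x₀ ⊞ (x₂ ⊞ x₃)) ⊞ (x₁ ⊞ x₂))) ⊞ x₀) x₃ refl))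
        both : ∀ w → Ey[ e ] w ≡ true → (Ey[ e′ ] w ≡ true → ⊥) × (Ey[ e′ ] (w ⊕ s) ≡ true → ⊥)
        both w t = (λ t′ → clash (same rel) t′) , (λ t′ → clash (shifted rel) t′)
          where
          clash : ∀ {v} → ((e₁ ⊕ (w ⊕ (e ⊕ x))) ⊕ v ≡ x) ⊎ ((e₁ ⊕ (w ⊕ (e ⊕ x))) ⊕ v ≡ y) → Ey v ≡ true → ⊥
          clash rel′ t′ with no-relation adj₁ e₁≢y (proj₁ (Ey⇒ t)) (proj₂ (Ey⇒ t)) (Ey⊆A° t′) | rel′
          ... | no-x , _ | inj₁ q = no-x q
          ... | _ , no-y | inj₂ q = no-y q
          eq : (e₁ ⊕ (w ⊕ (e ⊕ x))) ⊕ (w ⊕ (e′ ⊕ x)) ≡ (e₁ ⊕ e) ⊕ e′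
          eq = xor-solve (e₁ ∷ w ∷ e ∷ x ∷ e′ ∷ []) ((x₀ ⊞ (x₁ ⊞ (x₂ ⊞ x₃))) ⊞ (x₁ ⊞ (x₄ ⊞ x₃))) ((x₀ ⊞ x₂) ⊞ x₄) refl
          eq′ : (e₁ ⊕ (w ⊕ (e ⊕ x))) ⊕ ((w ⊕ s) ⊕ (e′ ⊕ x)) ≡ ((e₁ ⊕ e) ⊕ e′) ⊕ s
          eq′ = xor-solve (e₁ ∷ w ∷ e ∷ x ∷ e′ ∷ y ∷ []) ((x₀ ⊞ (x₁ ⊞ (x₂ ⊞ x₃))) ⊞ ((x₁ ⊞ (x₃ ⊞ x₅)) ⊞ (x₄ ⊞ x₃)))
                  (((x₀ ⊞ x₂) ⊞ x₄) ⊞ (x₃ ⊞ x₅)) refl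
          same : ((e₁ ⊕ e) ⊕ e′ ≡ x) ⊎ ((e₁ ⊕ e) ⊕ e′ ≡ y) →
                 ((e₁ ⊕ (w ⊕ (e ⊕ x))) ⊕ (w ⊕ (e′ ⊕ x)) ≡ x) ⊎ ((e₁ ⊕ (w ⊕ (e ⊕ x))) ⊕ (w ⊕ (e′ ⊕ x)) ≡ y)
          same (inj₁ q) = inj₁ (trans eq q)
          same (inj₂ q) = inj₂ (trans eq q)
          -- Adding `s = x ⊕ y` exchanges the values `x` and `y`, hence the crossed injections.
          shifted : ((e₁ ⊕ e) ⊕ e′ ≡ x) ⊎ ((e₁ ⊕ e) ⊕ e′ ≡ y) →
                    ((e₁ ⊕ (w ⊕ (e ⊕ x))) ⊕ ((w ⊕ s) ⊕ (e′ ⊕ x)) ≡ x) ⊎ ((e₁ ⊕ (w ⊕ (e ⊕ x))) ⊕ ((w ⊕ s) ⊕ (e′ ⊕ x)) ≡ y)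
          shifted (inj₁ q) = inj₂ (trans eq′ (trans (cong (_⊕ s) q) (xor-solve (x ∷ y ∷ []) (x₀ ⊞ (x₀ ⊞ x₁)) x₁ refl)))
          shifted (inj₂ q) = inj₁ (trans eq′ (trans (cong (_⊕ s) q) (xor-solve (x ∷ y ∷ []) (x₁ ⊞ (x₀ ⊞ x₁)) x₀ refl)))
        bound : 2 * ∑ (χ A°) ≤ ∑ (χ A°) + ∑ (χ Ey[ e ]) + ∑ (χ Ey[ e′ ])
        bound rewrite ∑Ey[ e ] | ∑Ey[ e′ ] = begin
          2 * ∑ (χ A°)                              ≡⟨ cong (∑ (χ A°) +_) (+-identityʳ _) ⟩
          ∑ (χ A°) + ∑ (χ A°)                       ≤⟨ +-monoʳ-≤ (∑ (χ A°)) (≤-trans ∑A°≤ (+-monoˡ-≤ _ Ex≤Ey)) ⟩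
          ∑ (χ A°) + (∑ (χ Ey) + ∑ (χ Ey))          ≡⟨ sym (+-assoc (∑ (χ A°)) _ _) ⟩
          ∑ (χ A°) + ∑ (χ Ey) + ∑ (χ Ey)            ∎
          where open ≤-Reasoning

      -- By `no-triple`, `A°` is disjoint from its translates by `e₁ ⊕ x` and `e₁ ⊕ y`; together
      -- with the shift by `s` this packs four translates. The third set of `three-packing` is
      -- empty.
      impossible : ⊥
      impossible = overfull (≤-trans (*-monoʳ-≤ 2 bound)
        (three-packing s A° A°₁ (λ _ → false) A°-self self (λ _ ()) apart (λ _ _ → (λ ()) , (λ ())) (λ _ _ → (λ ()) , (λ ()))))
        where
        A°₁ : Subset₂ r
        A°₁ w = A° (w ⊕ (e₁ ⊕ x))
        self : ∀ w → A°₁ w ≡ true → A°₁ (w ⊕ s) ≡ true → ⊥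
        self w t t′ = A°-self (w ⊕ (e₁ ⊕ x)) t (trans (cong A°
          (xor-solve (w ∷ e₁ ∷ x ∷ y ∷ []) ((x₀ ⊞ (x₁ ⊞ x₂)) ⊞ (x₂ ⊞ x₃)) ((x₀ ⊞ (x₂ ⊞ x₃)) ⊞ (x₁ ⊞ x₂)) refl)) t′)
        apart : ∀ w → A° w ≡ true → (A°₁ w ≡ true → ⊥) × (A°₁ (w ⊕ s) ≡ true → ⊥)
        apart w pw =
            (λ t → no-triple pw t (inj₁ (xor-solve (w ∷ e₁ ∷ x ∷ []) ((x₁ ⊞ x₀) ⊞ (x₀ ⊞ (x₁ ⊞ x₂))) x₂ refl)))
          , (λ t → no-triple pw t (inj₂ (xor-solve (w ∷ e₁ ∷ x ∷ y ∷ [])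
               ((x₁ ⊞ x₀) ⊞ ((x₀ ⊞ (x₂ ⊞ x₃)) ⊞ (x₁ ⊞ x₂))) x₃ refl)))
        bound : 2 * ∑ (χ A°) ≤ ∑ (χ A°) + ∑ (χ A°₁) + ∑ (χ (λ (_ : V r) → false))
        bound rewrite ∑-shift (χ A°) (e₁ ⊕ x) =
          ≤-trans (≤-reflexive (cong (∑ (χ A°) +_) (+-identityʳ _))) (m≤m+n _ _)

  -- Roundness excludes isolated vertices

  module Isolated {a} (pa : A a ≡ true) (isolated : deg a ≡ 0) where

    B : Subset₂ r
    B = A ∖ a

    module _ {b} (pb : A b ≡ true) (b≢a : b ≢ a) where

      c : V r
      c = a ⊕ b

      F : Subset₂ r
      F w = A w ∧ A (w ⊕ c)

      pac : A (a ⊕ c) ≡ true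
      pac = trans (cong A (xor-solve (a ∷ b ∷ []) (x₀ ⊞ (x₀ ⊞ x₁)) x₁ refl)) pb

      pbc : A (b ⊕ c) ≡ true
      pbc = trans (cong A (xor-solve (a ∷ b ∷ []) (x₁ ⊞ (x₀ ⊞ x₁)) x₀ refl)) pa

      pca : A (c ⊕ a) ≡ true
      pca = trans (cong A (⊕-comm c a)) pac

      rep≤ : rep c ≤ ∑ (χ F)
      rep≤ = ∑-mono (λ w → 𝟙-∧ (A w) (A (w ⊕ c)))

      2≤rep : 2 ≤ rep c
      2≤rep = subst (_≤ rep c) (trans (∑-+ _ _) (cong₂ _+_ (∑-pt a) (∑-pt b))) (∑-mono pointwise)
        where
        at : ∀ {w} → A w ≡ true → A (w ⊕ c) ≡ true → 1 ≤ α w * α (w ⊕ c)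
        at p q = ≤-reflexive (sym (cong₂ _*_ (χ-true A p) (χ-true A q)))
        pointwise : ∀ w → pt a w + pt b w ≤ α w * α (w ⊕ c)
        pointwise w = go (w ≟ⱽ a) (w ≟ⱽ b)
          where
          go : Dec (w ≡ a) → Dec (w ≡ b) → pt a w + pt b w ≤ α w * α (w ⊕ c)
          go (yes t) (yes t′) = ⊥-elim (b≢a (trans (sym t′) t))
          go (yes refl) (no t) = ≤-trans (≤-reflexive (cong₂ _+_ (pt-same a) (pt-distinct t))) (at pa pac)
          go (no t) (yes refl) = ≤-trans (≤-reflexive (cong₂ _+_ (pt-distinct t) (pt-same b))) (at pb pbc)
          go (no t) (no t′) = ≤-trans (≤-reflexive (cong₂ _+_ (pt-distinct t) (pt-distinct t′))) z≤n

      not-unique : rep c ≢ 2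
      not-unique t = 1+n≢0 (trans (sym (cong₂ _*_ (χ-true U (rep≡2⇒U t)) (χ-true A pca)))
        (∑≡0⇒ (λ w → μ w * α (w ⊕ a)) isolated c))

      third-summand : ∃ λ w → ((F ∖ a) ∖ b) w ≡ true
      third-summand = ∑χ-inhabited _ (+-cancelʳ-≤ 2 1 _ (≤-trans (≤∧≢⇒< 2≤rep (λ t → not-unique (sym t))) (≤-trans rep≤
        (≤-trans (∑χ≤∑χ∖+1 F a) (≤-trans (+-monoˡ-≤ 1 (∑χ≤∑χ∖+1 (F ∖ a) b)) (≤-reflexive (+-assoc _ 1 1)))))))

      -- As `a` is isolated, `c` is not a unique sum and has a summand `w` other than `a` and `b`.
      -- Its partner `w ⊕ c` also differs from `a`, since it equals `a` only for `w = b`.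
      redundant : c ∈2 B
      redundant = w , w ⊕ c , ∖-intro A (∧-trueˡ {A w} in-F) (∖-≢ F (∖-⊆ (F ∖ a) p)) , ∖-intro A (∧-trueʳ {A w} in-F) w⊕c≢a
                , xor-solve (c ∷ w ∷ []) x₀ (x₁ ⊞ (x₁ ⊞ x₀)) refl
        where
        w = proj₁ third-summand
        p : ((F ∖ a) ∖ b) w ≡ true
        p = proj₂ third-summand
        in-F : F w ≡ true
        in-F = ∖-⊆ F (∖-⊆ (F ∖ a) p)
        w⊕c≢a : w ⊕ c ≢ a
        w⊕c≢a t = ∖-≢ (F ∖ a) p (trans (sym (⊕-cancelʳ w c))
          (trans (cong (_⊕ c) t) (xor-solve (a ∷ b ∷ []) (x₀ ⊞ (x₀ ⊞ x₁)) x₁ refl)))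

    proper : ProperSubset B A
    proper = (λ x p → ∖-⊆ A p) , a , pa , (λ p → ∖-≢ A p refl)

    𝟎∈2B : 𝟎 ∈2 B
    𝟎∈2B = b , b , proj₂ inhabited , proj₂ inhabited , sym (⊕-self b)
      where
      inhabited = ∑χ-inhabited B (+-cancelʳ-≤ 1 1 _ (≤-trans (≤-trans (n≤1+n 2) (<⇒≤ 3<n)) (∑χ≤∑χ∖+1 A a)))
      b = proj₁ inhabited

    backward : ∀ c₁ c₂ → A c₁ ≡ true → A c₂ ≡ true → Dec (c₁ ≡ a) → Dec (c₂ ≡ a) → (c₁ ⊕ c₂) ∈2 B
    backward c₁ c₂ p q (no t)     (no t′)    = c₁ , c₂ , ∖-intro A p t , ∖-intro A q t′ , refl
    backward c₁ c₂ p q (yes refl) (no t)     = redundant q t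
    backward c₁ c₂ p q (no t)     (yes refl) = subst (_∈2 B) (⊕-comm c₂ c₁) (redundant p t)
    backward c₁ c₂ p q (yes refl) (yes refl) = subst (_∈2 B) (sym (⊕-self c₁)) 𝟎∈2B

    same-doubling : SameDoubling B A
    same-doubling x = mk⇔ (λ { (c₁ , c₂ , p , q , t) → c₁ , c₂ , ∖-⊆ A p , ∖-⊆ A q , t })
      (λ { (c₁ , c₂ , p , q , t) → subst (_∈2 B) (sym t) (backward c₁ c₂ p q (c₁ ≟ⱽ a) (c₂ ≟ⱽ a)) })

  round⇒covered : Round A → ∀ {a} → A a ≡ true → ∃ λ u → Edge a u
  round⇒covered round {a} pa = go (deg a ≟ 0)
    where
    go : Dec (deg a ≡ 0) → ∃ λ u → Edge a u
    go (yes isolated) = ⊥-elim (round (Isolated.B pa isolated) (Isolated.proper pa isolated) (Isolated.same-doubling pa isolated))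
    go (no p) = u , pa , trans (cong A (⊕-comm a u)) (𝟙≢0⇒ (A (u ⊕ a)) (λ t → q (trans (cong (μ u *_) t) (*-zeroʳ (μ u)))))
                  , 𝟙≢0⇒ (U u) (λ t → q (cong (_* α (u ⊕ a)) t))
      where
      found = ∑≢0⇒∃ (λ w → μ w * α (w ⊕ a)) p
      u = proj₁ found
      q : μ u * α (u ⊕ a) ≢ 0
      q = proj₂ found

  -- A relation `c = c₁ ⊕ c₂` in `S` would represent the unique sum of `g` and `g ⊕ c` a second
  -- time, by `g ⊕ c₁` and `g ⊕ c₂`.
  star⇒translate : ∀ {g} → A g ≡ true → (∀ {a} → A a ≡ true → a ≢ g → Adj g a) →
                   ∃ λ (S : Subset₂ r) → ∃ λ (g : V r) → SumFree S × IsTranslateOfSZero A g S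
  star⇒translate {g} pg star = S , g , sumFree , (λ x → mk⇔ forward backward)
    where
    S S₀ : Subset₂ r
    S₀ x = A (g ⊕ x)
    S = S₀ ∖ 𝟎
    recover : ∀ v w → v ⊕ (v ⊕ w) ≡ w
    recover v w = xor-solve (v ∷ w ∷ []) (x₀ ⊞ (x₀ ⊞ x₁)) x₁ refl
    cancel : ∀ {v w} → g ⊕ v ≡ g ⊕ w → v ≡ w
    cancel {v} {w} t = trans (sym (recover g v)) (trans (cong (g ⊕_) t) (recover g w))
    sumFree : SumFree S
    sumFree c (pc , c₁ , c₂ , p₁ , p₂ , eq) = go (adj-unique (star (∖-⊆ S₀ pc) g⊕c≢g) (∖-⊆ S₀ p₁)
      (trans (cong A (trans (cong (λ v → (g ⊕ c₁) ⊕ (g ⊕ (g ⊕ v))) eq)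
        (xor-solve (g ∷ c₁ ∷ c₂ ∷ []) ((x₀ ⊞ x₁) ⊞ (x₀ ⊞ (x₀ ⊞ (x₁ ⊞ x₂)))) (x₀ ⊞ x₂) refl))) (∖-⊆ S₀ p₂)))
      where
      g⊕c≢g : g ⊕ c ≢ g
      g⊕c≢g t = ∖-≢ S₀ pc (cancel (trans t (sym (⊕-identityʳ g))))
      go : (g ⊕ c₁ ≡ g) ⊎ (g ⊕ c₁ ≡ g ⊕ c) → ⊥
      go (inj₁ t) = ∖-≢ S₀ p₁ (cancel (trans t (sym (⊕-identityʳ g))))
      go (inj₂ t) = ∖-≢ S₀ p₂ (trans (sym (recover c₁ c₂)) (trans (cong (c₁ ⊕_) (sym eq))
                      (trans (cong (c₁ ⊕_) (sym (cancel t))) (⊕-self c₁))))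
    forward : ∀ {x} → x ∈ₛ A → ∃ λ y → (y ∈ₛ S ⊎ y ≡ 𝟎) × x ≡ g ⊕ y
    forward {x} px with (g ⊕ x) ≟ⱽ 𝟎
    ... | yes t = 𝟎 , inj₂ refl , trans (sym (⊕≡𝟎⇒≡ t)) (sym (⊕-identityʳ g))
    ... | no t  = g ⊕ x , inj₁ (∖-intro S₀ (trans (cong A back) px) t) , sym back
      where
      back : g ⊕ (g ⊕ x) ≡ x
      back = xor-solve (g ∷ x ∷ []) (x₀ ⊞ (x₀ ⊞ x₁)) x₁ refl
    backward : ∀ {x} → (∃ λ y → (y ∈ₛ S ⊎ y ≡ 𝟎) × x ≡ g ⊕ y) → x ∈ₛ A
    backward (y , inj₁ py , refl)   = ∖-⊆ S₀ py
    backward (y , inj₂ refl , refl) = trans (cong A (⊕-identityʳ g)) pg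

  -- Counting along a maximal matching

  module Covered (covered : ∀ {a} → A a ≡ true → ∃ λ u → Edge a u) where

    1≤deg : ∀ {a} → A a ≡ true → 1 ≤ deg a
    1≤deg p with covered p
    ... | u , _ , q , s = 1≤tdeg U s q

    -- By `edge-sum`, the degree sum of the two ends of the edge `u`.
    dd : V r → ℕ
    dd = corr (λ a → α a * deg a) α

    module MaximalMatching (R : Subset₂ r) (mt : Matching R) (maximal : Maximal R) where

      -- Since `δ` is at most 1 on `A`, the function `β` is the indicator of the unmatched vertices.
      ρ δ β : V r → ℕ
      ρ = χ R
      δ = tdeg R
      β a = α a * (1 ∸ δ a)

      k b D : ℕ
      k = ∑ ρ
      b = ∑ β
      D = ∑ (λ u → ρ u * dd u)

      α-split : ∀ a → α a ≡ α a * δ a + β a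
      α-split a with A a in p
      ... | false = refl
      ... | true with δ a | proj₂ mt p
      ... | zero     | _ = refl
      ... | suc zero | _ = refl
      ... | suc (suc _) | s≤s ()

      ∑αδ : ∑ (λ a → α a * δ a) ≡ 2 * k
      ∑αδ = trans (sym (corr-swap ρ α α)) (trans (∑-cong pointwise) (∑-*ˡ 2 ρ))
        where
        pointwise : ∀ u → ρ u * rep u ≡ 2 * ρ u
        pointwise u with R u in p
        ... | true  = trans (+-identityʳ _) (rep≡2 (proj₁ mt p))
        ... | false = refl

      n≡2k+b : n ≡ 2 * k + b
      n≡2k+b = trans (∑-cong α-split) (trans (∑-+ _ β) (cong (_+ b) ∑αδ))

      b≤∑βdeg : b ≤ ∑ (λ a → β a * deg a)
      b≤∑βdeg = ∑-mono pointwise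
        where
        pointwise : ∀ a → β a ≤ β a * deg a
        pointwise a with A a in p
        ... | false = z≤n
        ... | true  = ≤-trans (≤-reflexive (sym (*-identityʳ _))) (*-monoʳ-≤ (1 * (1 ∸ δ a)) (1≤deg p))

      -- By maximality an edge outside the matching has at most one unmatched end, and a matching
      -- edge has none.
      unmatched-pointwise : ∀ u → μ u * corr β α u + ρ u ≤ μ u
      unmatched-pointwise u with U u in p
      ... | false with R u in q
      ...   | false = z≤n
      ...   | true  = ⊥-elim (true≢false (trans (sym (proj₁ mt q)) p))
      unmatched-pointwise u | true with endpoint p
      ... | x , e@(px , pxu , _) rewrite edge-sum e (λ a → 1 ∸ δ a) with R u in q
      ... | true rewrite ≤-antisym (proj₂ mt px) (1≤tdeg R q pxu)
                       | ≤-antisym (proj₂ mt pxu) (1≤tdeg R q (proj₁ (proj₂ (edge-flip e)))) = ≤-refl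
      ... | false with δ x | δ (x ⊕ u) | proj₂ mt px | proj₂ mt pxu | maximal e
      ... | zero     | suc zero | _ | _ | _ = ≤-refl
      ... | suc zero | zero     | _ | _ | _ = ≤-refl
      ... | suc zero | suc zero | _ | _ | _ = z≤n
      ... | suc (suc _) | _ | s≤s () | _ | _
      ... | _ | suc (suc _) | _ | s≤s () | _

      k+b≤m : k + b ≤ m
      k+b≤m = begin
        k + b                                    ≤⟨ +-monoʳ-≤ k b≤∑βdeg ⟩
        k + ∑ (λ a → β a * deg a)                ≡⟨ +-comm k _ ⟩
        ∑ (λ a → β a * deg a) + k                ≡⟨ cong (_+ k) (sym (corr-swap μ β α)) ⟩
        ∑ (λ u → μ u * corr β α u) + k           ≡⟨ sym (∑-+ _ ρ) ⟩
        ∑ (λ u → μ u * corr β α u + ρ u)         ≤⟨ ∑-mono unmatched-pointwise ⟩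
        m                                        ∎
        where open ≤-Reasoning

      -- In the degree total `2 m` the matched vertices contribute `D` and each unmatched one at
      -- least 1.
      D+b≤2m : D + b ≤ 2 * m
      D+b≤2m = begin
        D + b                                                       ≤⟨ +-monoʳ-≤ D b≤∑βdeg ⟩
        D + ∑ (λ a → β a * deg a)                                   ≡⟨ cong (_+ ∑ (λ a → β a * deg a)) (corr-swap ρ (λ a → α a * deg a) α) ⟩
        ∑ (λ a → α a * deg a * δ a) + ∑ (λ a → β a * deg a)         ≡⟨ sym (∑-+ _ _) ⟩
        ∑ (λ a → α a * deg a * δ a + β a * deg a)                   ≡⟨ ∑-cong (λ a →
            trans (factor (α a) (deg a) (δ a) (β a)) (cong (_* deg a) (sym (α-split a)))) ⟩
        ∑ (λ a → α a * deg a)                                       ≡⟨ ∑α*deg ⟩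
        2 * m                                                       ∎
        where
        open ≤-Reasoning
        factor : ∀ a d e f → a * d * e + f * d ≡ (a * e + f) * d
        factor = solve-∀

      kτ≤D : ∀ τ → (∀ {x u} → Edge x u → τ ≤ deg x + deg (x ⊕ u)) → k * τ ≤ D
      kτ≤D τ bound = ≤-trans (≤-reflexive (sym (∑-*ʳ τ ρ))) (∑-mono pointwise)
        where
        pointwise : ∀ u → ρ u * τ ≤ ρ u * dd u
        pointwise u with R u in p
        ... | false = z≤n
        ... | true with endpoint (proj₁ mt p)
        ... | x , e = *-monoʳ-≤ 1 (≤-trans (bound e) (≤-reflexive (sym (edge-sum e deg))))

      -- The light matching edges, to which `rep-lower` applies.
      R₃ : Subset₂ r
      R₃ u = R u ∧ (dd u ≤ᵇ 3)

      ρ₃ : V r → ℕ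
      ρ₃ = χ R₃

      k₃ : ℕ
      k₃ = ∑ ρ₃

      ρ₃≤ρ : ∀ u → ρ₃ u ≤ ρ u
      ρ₃≤ρ u with R u
      ... | true  = 𝟙≤1 _
      ... | false = z≤n

      R⇒μ≡1 : ∀ {u} → R u ≡ true → μ u ≡ 1
      R⇒μ≡1 p = χ-true U (proj₁ mt p)

      -- A light edge has degree sum at least 2, since no vertex is isolated, and any other matching
      -- edge at least 4.
      4k≤2k₃+D : 4 * k ≤ 2 * k₃ + D
      4k≤2k₃+D = subst₂ _≤_ (∑-*ˡ 4 ρ) (trans (∑-+ _ _) (cong (_+ D) (∑-*ˡ 2 ρ₃))) (∑-mono pointwise)
        where
        pointwise : ∀ u → 4 * ρ u ≤ 2 * ρ₃ u + ρ u * dd u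
        pointwise u with R u in p
        ... | false = z≤n
        ... | true with endpoint (proj₁ mt p)
        ... | x , e@(px , pxu , _) with dd u ≤ᵇ 3 in q
        ... | true = +-monoʳ-≤ 2 (≤-trans (subst (2 ≤_) (sym (edge-sum e deg)) (+-mono-≤ (1≤deg px) (1≤deg pxu)))
                       (≤-reflexive (sym (+-identityʳ _))))
        ... | false = ≤-trans (≰⇒> (λ le → subst T q (≤⇒≤ᵇ le))) (≤-reflexive (sym (+-identityʳ _)))

      -- By `edge-sum`, the number of ends of the edge `u` that `z` moves into `A`.
      q : V r → V r → ℕ
      q z = corr (λ a → α a * α (a ⊕ z)) α

      -- PA and BA split rep by whether the first summand is matched; ex counts the matching edges u
      -- for which u + z is a unique sum although an end of u is moved into A by z.
      PA BA UR UR₃ ex : V r → ℕ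
      PA  = corr (λ a → α a * δ a) α
      BA  = corr β α
      UR  = corr ρ μ
      UR₃ = corr ρ₃ μ
      ex z = ∑ (λ u → ρ u * (μ (u ⊕ z) * q z u))

      rep-split : ∀ z → rep z ≡ PA z + BA z
      rep-split z = trans (∑-cong (λ a → trans (cong (_* α (a ⊕ z)) (α-split a)) (*-distribʳ-+ (α (a ⊕ z)) (α a * δ a) (β a))))
                          (∑-+ _ _)

      PA-swap : ∀ z → PA z ≡ ∑ (λ u → ρ u * q z u)
      PA-swap z = trans (∑-cong (λ a → swap (α a) (δ a) (α (a ⊕ z)))) (sym (corr-swap ρ (λ a → α a * α (a ⊕ z)) α))
        where
        swap : ∀ a b c → a * b * c ≡ a * c * b
        swap = solve-∀

      -- If both ends x, x + u moved into A under z, then u would be represented a second time.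
      q≤1 : ∀ {z u} → U z ≡ false → z ≢ 𝟎 → U u ≡ true → q z u ≤ 1
      q≤1 {z} {u} z∉U z≢𝟎 p with endpoint p
      ... | x , e rewrite edge-sum e (λ a → α (a ⊕ z)) with A (x ⊕ z) in s | A ((x ⊕ u) ⊕ z) in s′
      ... | false | b     = 𝟙≤1 b
      ... | true  | false = ≤-refl
      ... | true  | true  with edge-unique e s
                              (trans (cong A (xor-solve (x ∷ z ∷ u ∷ []) ((x₀ ⊞ x₁) ⊞ x₂) ((x₀ ⊞ x₂) ⊞ x₁) refl)) s′)
      ... | inj₁ eq = ⊥-elim (z≢𝟎 (trans (xor-solve (x ∷ z ∷ []) x₁ (x₀ ⊞ (x₀ ⊞ x₁)) refl) (trans (cong (x ⊕_) eq) (⊕-self x))))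
      ... | inj₂ eq = ⊥-elim (true≢false (trans (sym p) (trans (cong U u≡z) z∉U)))
        where
        u≡z : u ≡ z
        u≡z = trans (xor-solve (x ∷ u ∷ []) x₁ (x₀ ⊞ (x₀ ⊞ x₁)) refl)
                (trans (cong (x ⊕_) (sym eq)) (xor-solve (x ∷ z ∷ []) (x₀ ⊞ (x₀ ⊞ x₁)) x₁ refl))

      -- For the 0-1 values `q z u` and `μ (u ⊕ z)` the product `(1 - q)(1 - μ)` is nonnegative.
      -- This bounds `rep` from above up to `ex`, whose total over `z` is just `D`.
      PA+UR≤k+ex : ∀ {z} → U z ≡ false → z ≢ 𝟎 → PA z + UR z ≤ k + ex z
      PA+UR≤k+ex {z} z∉U z≢𝟎 = subst₂ _≤_ (trans (∑-+ _ _) (cong (_+ UR z) (sym (PA-swap z)))) (∑-+ _ _) (∑-mono pointwise)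
        where
        bits : ∀ i j → i ≤ 1 → j ≤ 1 → i + j ≤ 1 + j * i
        bits zero j p s = ≤-trans s (m≤m+n 1 _)
        bits (suc zero) j p s = ≤-reflexive (cong suc (sym (*-identityʳ j)))
        bits (suc (suc _)) j (s≤s ()) s
        pointwise : ∀ u → ρ u * q z u + ρ u * μ (u ⊕ z) ≤ ρ u + ρ u * (μ (u ⊕ z) * q z u)
        pointwise u with R u in p
        ... | false = z≤n
        ... | true  = subst₂ _≤_ (sym (cong₂ _+_ (*-identityˡ (q z u)) (*-identityˡ (μ (u ⊕ z)))))
                        (cong suc (sym (*-identityˡ (μ (u ⊕ z) * q z u))))
                        (bits (q z u) (μ (u ⊕ z)) (q≤1 z∉U z≢𝟎 (proj₁ mt p)) (𝟙≤1 (U (u ⊕ z))))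

      -- For an end `x` of `u`, shifting `z` by `u` turns the counted values into edges at the other
      -- end; each matching edge thus contributes its degree sum.
      ∑ex : ∑ ex ≡ D
      ∑ex = trans (∑-swap (λ z u → ρ u * (μ (u ⊕ z) * q z u)))
                  (∑-cong (λ u → trans (∑-*ˡ (ρ u) (λ z → μ (u ⊕ z) * q z u)) (inner u)))
        where
        half : ∀ u x → ∑ (λ z → μ (u ⊕ z) * α (x ⊕ z)) ≡ deg (x ⊕ u)
        half u x = trans (sym (∑-shift (λ z → μ (u ⊕ z) * α (x ⊕ z)) u))
          (∑-cong (λ z → cong₂ (λ s t → μ s * α t)
            (xor-solve (u ∷ z ∷ []) (x₀ ⊞ (x₁ ⊞ x₀)) x₁ refl)
            (xor-solve (x ∷ z ∷ u ∷ []) (x₀ ⊞ (x₁ ⊞ x₂)) (x₁ ⊞ (x₀ ⊞ x₂)) refl)))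
        inner : ∀ u → ρ u * ∑ (λ z → μ (u ⊕ z) * q z u) ≡ ρ u * dd u
        inner u with R u in p
        ... | false = refl
        ... | true with endpoint (proj₁ mt p)
        ... | x , e = cong (1 *_) (begin
          ∑ (λ z → μ (u ⊕ z) * q z u)                                     ≡⟨ ∑-cong (λ z →
              trans (cong (μ (u ⊕ z) *_) (edge-sum e (λ a → α (a ⊕ z)))) (*-distribˡ-+ (μ (u ⊕ z)) _ _)) ⟩
          ∑ (λ z → μ (u ⊕ z) * α (x ⊕ z) + μ (u ⊕ z) * α ((x ⊕ u) ⊕ z))   ≡⟨ ∑-+ _ _ ⟩
          _                                                               ≡⟨ cong₂ _+_ (half u x)
                                                  (trans (half u (x ⊕ u)) (cong deg (⊕-cancelʳ x u))) ⟩
          deg (x ⊕ u) + deg x                                             ≡⟨ +-comm (deg (x ⊕ u)) (deg x) ⟩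
          deg x + deg (x ⊕ u)                                             ≡⟨ sym (edge-sum e deg) ⟩
          dd u                                                            ∎)
          where open ≡-Reasoning

      -- Summation of `(μ - ρ₃)(w) (μ - ρ₃)(w ⊕ z) ≥ 0`.
      2UR₃≤ : ∀ z → 2 * UR₃ z ≤ corr μ μ z + corr ρ₃ ρ₃ z
      2UR₃≤ z = subst₂ _≤_ lhs (∑-+ _ _) (∑-mono pointwise)
        where
        lhs : ∑ (λ w → ρ₃ w * μ (w ⊕ z) + μ w * ρ₃ (w ⊕ z)) ≡ 2 * UR₃ z
        lhs = trans (∑-+ _ _) (cong (UR₃ z +_) (trans (corr-comm μ ρ₃ z) (sym (+-identityʳ _))))
        ρ₃≤μ : ∀ w → ρ₃ w ≤ μ w
        ρ₃≤μ w with R w in p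
        ... | true rewrite R⇒μ≡1 p = 𝟙≤1 _
        ... | false = z≤n
        pointwise : ∀ w → ρ₃ w * μ (w ⊕ z) + μ w * ρ₃ (w ⊕ z) ≤ μ w * μ (w ⊕ z) + ρ₃ w * ρ₃ (w ⊕ z)
        pointwise w = ≤-trans (≤-reflexive (+-comm (ρ₃ w * μ (w ⊕ z)) _)) (rearrangement (ρ₃≤μ w) (ρ₃≤μ (w ⊕ z)))

      UR₃⇒rep : ∀ z → UR₃ z ≢ 0 → corr μ μ z + 2 * n ≤ M + rep z + 8
      UR₃⇒rep z p with ∑≢0⇒∃ (λ w → ρ₃ w * μ (w ⊕ z)) p
      ... | u , s = lemma (𝟙≢0⇒ (R₃ u) (λ t → s (cong (_* μ (u ⊕ z)) t)))
                          (𝟙≢0⇒ (U (u ⊕ z)) (λ t → s (trans (cong (ρ₃ u *_) t) (*-zeroʳ (ρ₃ u)))))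
        where
        lemma : R₃ u ≡ true → U (u ⊕ z) ≡ true → corr μ μ z + 2 * n ≤ M + rep z + 8
        lemma p₃ pz with endpoint (proj₁ mt (∧-trueˡ {R u} p₃))
        ... | x , e = subst (λ v → corr μ μ v + 2 * n ≤ M + rep v + 8)
          (xor-solve (u ∷ z ∷ []) ((x₀ ⊞ x₁) ⊞ x₀) x₁ refl)
          (rep-lower e (subst (_≤ 3) (edge-sum e deg) (≤ᵇ⇒≤ (dd u) 3 (subst T (sym (∧-trueʳ {R u} p₃)) tt))) pz)

      -- Summation over all `z` when `m + n` is small

      module Count (C : ℕ) (C-eq : 2 * n + C ≡ M + 8 + k) where

        -- Two copies of `UR₃` enter through the lower bound for `rep z`, the third through `UR` in
        -- the upper bound; `C` is the gap between the constants of the two bounds.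
        generic : ∀ {z} → U z ≡ false → z ≢ 𝟎 → 3 * UR₃ z ≤ C + ex z + BA z + corr ρ₃ ρ₃ z
        generic {z} z∉U z≢𝟎 with UR₃ z ≟ 0
        ... | yes p rewrite p = z≤n
        ... | no p = +-cancelʳ-≤ (2 * n) _ _ (begin
          3 * UR₃ z + 2 * n                                        ≡⟨ cong (_+ 2 * n) (three (UR₃ z)) ⟩
          2 * UR₃ z + UR₃ z + 2 * n                                ≤⟨ +-monoˡ-≤ (2 * n) (+-mono-≤ (2UR₃≤ z)
                                                                        (∑-mono (λ w → *-monoˡ-≤ (μ (w ⊕ z)) (ρ₃≤ρ w)))) ⟩
          corr μ μ z + corr ρ₃ ρ₃ z + UR z + 2 * n                 ≡⟨ move (corr μ μ z) (corr ρ₃ ρ₃ z) (UR z) (2 * n) ⟩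
          corr μ μ z + 2 * n + (corr ρ₃ ρ₃ z + UR z)               ≤⟨ +-monoˡ-≤ _ (UR₃⇒rep z p) ⟩
          M + rep z + 8 + (corr ρ₃ ρ₃ z + UR z)                    ≡⟨ cong (λ t → M + t + 8 + (corr ρ₃ ρ₃ z + UR z)) (rep-split z) ⟩
          M + (PA z + BA z) + 8 + (corr ρ₃ ρ₃ z + UR z)            ≡⟨ move′ M (PA z) (BA z) (corr ρ₃ ρ₃ z) (UR z) ⟩
          M + 8 + (PA z + UR z) + (BA z + corr ρ₃ ρ₃ z)            ≤⟨ +-monoˡ-≤ _ (+-monoʳ-≤ (M + 8) (PA+UR≤k+ex z∉U z≢𝟎)) ⟩
          M + 8 + (k + ex z) + (BA z + corr ρ₃ ρ₃ z)               ≡⟨ move″ (M + 8) k (ex z) (BA z) (corr ρ₃ ρ₃ z) ⟩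
          M + 8 + k + (ex z + BA z + corr ρ₃ ρ₃ z)                 ≡⟨ cong (_+ (ex z + BA z + corr ρ₃ ρ₃ z)) (sym C-eq) ⟩
          2 * n + C + (ex z + BA z + corr ρ₃ ρ₃ z)                 ≡⟨ move‴ (2 * n) C (ex z) (BA z) (corr ρ₃ ρ₃ z) ⟩
          C + ex z + BA z + corr ρ₃ ρ₃ z + 2 * n                   ∎)
          where
          open ≤-Reasoning
          three : ∀ a → 3 * a ≡ 2 * a + a
          three = solve-∀
          move : ∀ a b c d → a + b + c + d ≡ a + d + (b + c)
          move = solve-∀
          move′ : ∀ a b c d e → a + (b + c) + 8 + (d + e) ≡ a + 8 + (b + e) + (c + d)
          move′ = solve-∀
          move″ : ∀ a b c d e → a + (b + c) + (d + e) ≡ a + b + (c + d + e)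
          move″ = solve-∀
          move‴ : ∀ a b c d e → a + b + (c + d + e) ≡ b + c + d + e + a
          move‴ = solve-∀

        UR₃-sum-free : ∀ {z} → U z ≡ true → UR₃ z ≡ 0
        UR₃-sum-free {z} p = trans (∑-cong pointwise) (∑-0 r)
          where
          pointwise : ∀ w → ρ₃ w * μ (w ⊕ z) ≡ 0
          pointwise w with R w in q₁ | U (w ⊕ z) in q₂
          ... | false | _     = refl
          ... | true  | false = *-zeroʳ (𝟙 (dd w ≤ᵇ 3))
          ... | true  | true  = ⊥-elim (sum-free (proj₁ mt q₁) p q₂)

        UR₃-𝟎 : UR₃ 𝟎 ≤ k₃
        UR₃-𝟎 = ≤-trans (≤-reflexive (corr-𝟎 ρ₃ μ))
          (∑-mono (λ w → ≤-trans (*-monoʳ-≤ (ρ₃ w) (𝟙≤1 (U w))) (≤-reflexive (*-identityʳ _))))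

        ex-𝟎 : 2 * k ≤ ex 𝟎
        ex-𝟎 = subst (_≤ ex 𝟎) (∑-*ˡ 2 ρ) (∑-mono pointwise)
          where
          pointwise : ∀ u → 2 * ρ u ≤ ρ u * (μ (u ⊕ 𝟎) * q 𝟎 u)
          pointwise u with R u in p
          ... | false = z≤n
          ... | true with endpoint (proj₁ mt p)
          ... | x , e@(px , pxu , pu) = ≤-reflexive (sym (trans (+-identityʳ _) (cong₂ _*_
                (trans (cong μ (⊕-identityʳ u)) (χ-true U pu))
                (trans (edge-sum e (λ a → α (a ⊕ 𝟎))) (cong₂ _+_
                  (χ-true A (trans (cong A (⊕-identityʳ x)) px))
                  (χ-true A (trans (cong A (⊕-identityʳ (x ⊕ u))) pxu)))))))

        BA-𝟎 : b ≤ BA 𝟎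
        BA-𝟎 = ≤-trans (∑-mono pointwise) (≤-reflexive (sym (corr-𝟎 β α)))
          where
          pointwise : ∀ a → β a ≤ β a * α a
          pointwise a with A a
          ... | true  = ≤-reflexive (sym (*-identityʳ _))
          ... | false = z≤n

        ρ₃ρ₃-𝟎 : k₃ ≤ corr ρ₃ ρ₃ 𝟎
        ρ₃ρ₃-𝟎 = ≤-trans (∑-mono (λ w → pointwise (R₃ w))) (≤-reflexive (sym (corr-𝟎 ρ₃ ρ₃)))
          where
          pointwise : ∀ c → 𝟙 c ≤ 𝟙 c * 𝟙 c
          pointwise true  = ≤-refl
          pointwise false = z≤n

        -- The extra terms on the left record savings. On `U` the count `UR₃` vanishes by
        -- sum-freeness, which frees `C + BA z`; at `𝟎` the first four terms on the right are at
        -- least `C + 2 * k + b + k₃`, and `UR₃ 𝟎` is at most `k₃`.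
        pointwise : ∀ z → 3 * UR₃ z + (pt 𝟎 z * (C + 2 * k + b + k₃) + (C * μ z + μ z * BA z))
                          ≤ C + ex z + BA z + corr ρ₃ ρ₃ z + pt 𝟎 z * (3 * k₃)
        pointwise z with z ≟ⱽ 𝟎
        ... | yes refl rewrite pt-same {r} 𝟎 with U 𝟎 in p
        ...   | true = ⊥-elim (U⇒≢𝟎 p refl)
        ...   | false = begin
          3 * UR₃ 𝟎 + (1 * (C + 2 * k + b + k₃) + (C * 0 + 0))          ≡⟨ tidy (3 * UR₃ 𝟎) C (2 * k) b k₃ ⟩
          C + 2 * k + b + k₃ + 3 * UR₃ 𝟎                                ≤⟨ +-mono-≤ (+-mono-≤ (+-mono-≤ (+-monoʳ-≤ C ex-𝟎) BA-𝟎) ρ₃ρ₃-𝟎)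
                                                                             (*-monoʳ-≤ 3 UR₃-𝟎) ⟩
          C + ex 𝟎 + BA 𝟎 + corr ρ₃ ρ₃ 𝟎 + 3 * k₃                       ≡⟨ cong (C + ex 𝟎 + BA 𝟎 + corr ρ₃ ρ₃ 𝟎 +_) (sym (*-identityˡ (3 * k₃))) ⟩
          C + ex 𝟎 + BA 𝟎 + corr ρ₃ ρ₃ 𝟎 + 1 * (3 * k₃)                 ∎
          where
          open ≤-Reasoning
          tidy : ∀ a c d e f → a + (1 * (c + d + e + f) + (c * 0 + 0)) ≡ c + d + e + f + a
          tidy = solve-∀
        pointwise z | no z≢𝟎 rewrite pt-distinct z≢𝟎 with U z in p
        ... | true rewrite UR₃-sum-free p = begin
          C * 1 + (BA z + 0)                                  ≡⟨ cong₂ _+_ (*-identityʳ C) (+-identityʳ (BA z)) ⟩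
          C + BA z                                            ≤⟨ +-monoˡ-≤ (BA z) (m≤m+n C (ex z)) ⟩
          C + ex z + BA z                                     ≤⟨ m≤m+n _ _ ⟩
          C + ex z + BA z + corr ρ₃ ρ₃ z                      ≤⟨ m≤m+n _ 0 ⟩
          C + ex z + BA z + corr ρ₃ ρ₃ z + 0                  ∎
          where open ≤-Reasoning
        ... | false = begin
          3 * UR₃ z + (C * 0 + 0)                             ≡⟨ tidy (3 * UR₃ z) C ⟩
          3 * UR₃ z                                           ≤⟨ generic p z≢𝟎 ⟩
          C + ex z + BA z + corr ρ₃ ρ₃ z                      ≤⟨ m≤m+n _ 0 ⟩
          C + ex z + BA z + corr ρ₃ ρ₃ z + 0                  ∎
          where
          open ≤-Reasoning
          tidy : ∀ a c → a + (c * 0 + 0) ≡ a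
          tidy = solve-∀

        total : 3 * (k₃ * m) + ((C + 2 * k + b + k₃) + (C * m + b)) ≤ 2 * M * C + D + b * n + k₃ * k₃ + 3 * k₃
        total = begin
          3 * (k₃ * m) + ((C + 2 * k + b + k₃) + (C * m + b))
            ≤⟨ +-monoʳ-≤ (3 * (k₃ * m)) (+-monoʳ-≤ (C + 2 * k + b + k₃) (+-monoʳ-≤ (C * m) b≤∑βdeg)) ⟩
          3 * (k₃ * m) + ((C + 2 * k + b + k₃) + (C * m + ∑ (λ a → β a * deg a)))
            ≡⟨ sym lhs ⟩
          _ ≤⟨ ∑-mono pointwise ⟩
          _ ≡⟨ rhs ⟩
          2 * M * C + D + b * n + k₃ * k₃ + 3 * k₃ ∎
          where
          open ≤-Reasoning
          lhs : ∑ (λ z → 3 * UR₃ z + (pt 𝟎 z * (C + 2 * k + b + k₃) + (C * μ z + μ z * BA z)))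
                ≡ 3 * (k₃ * m) + ((C + 2 * k + b + k₃) + (C * m + ∑ (λ a → β a * deg a)))
          lhs = trans (∑-+ _ _) (cong₂ _+_ (trans (∑-*ˡ 3 UR₃) (cong (3 *_) (∑-corr ρ₃ μ)))
                  (trans (∑-+ _ _) (cong₂ _+_ (∑-pt* 𝟎 (λ _ → C + 2 * k + b + k₃))
                    (trans (∑-+ _ _) (cong₂ _+_ (∑-*ˡ C μ) (corr-swap μ β α))))))
          rhs : ∑ (λ z → C + ex z + BA z + corr ρ₃ ρ₃ z + pt 𝟎 z * (3 * k₃)) ≡ 2 * M * C + D + b * n + k₃ * k₃ + 3 * k₃
          rhs = trans (∑-+ _ _) (cong₂ _+_ (trans (∑-+ _ _) (cong₂ _+_ (trans (∑-+ _ _) (cong₂ _+_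
                  (trans (∑-+ _ _) (cong₂ _+_ (trans (∑-const r C) (cong (_* C) 2^r≡2M)) ∑ex))
                  (∑-corr β α))) (∑-corr ρ₃ ρ₃))) (∑-pt* 𝟎 (λ _ → 3 * k₃)))

      sparse : (∃ λ j → M ≡ 2 ^ j) → m + n ≤ M + 2 → ⊥
      sparse (j , M≡) m+n≤ with m≤n⇒∃[o]m+o≡n 2n≤
        where
        open ≤-Reasoning
        -- Makes `C = M + 8 + k - 2 n` a natural number without truncation.
        2n≤ : 2 * n ≤ M + 8 + k
        2n≤ = +-cancelʳ-≤ b _ _ (begin
          2 * n + b                    ≡⟨ cong (λ t → n + (t + 0) + b) n≡2k+b ⟩
          n + (2 * k + b + 0) + b      ≡⟨ move n k b ⟩
          k + b + n + (k + b)          ≤⟨ +-monoˡ-≤ (k + b) (≤-trans (+-monoˡ-≤ n k+b≤m) m+n≤) ⟩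
          M + 2 + (k + b)              ≤⟨ +-monoˡ-≤ (k + b) (+-monoʳ-≤ M (m≤m+n 2 6)) ⟩
          M + 8 + (k + b)              ≡⟨ sym (+-assoc (M + 8) k b) ⟩
          M + 8 + k + b                ∎)
          where
          move : ∀ n k b → n + (2 * k + b + 0) + b ≡ k + b + n + (k + b)
          move = solve-∀
      ... | C , C-eq = sparse-arithmetic M n m k b k₃ D C n≡2k+b k+b≤m D+b≤2m 4k≤2k₃+D (∑-mono ρ₃≤ρ)
                         C-eq m+n≤ large (subst (λ t → 128 ≤ t ⊎ 11 * t + 70 ≤ 18 * n) (sym M≡)
                           (power-of-two-bound j n (subst (λ t → 11 * t + 54 < 18 * n) M≡ large)
                             (subst (λ t → 3 * n ≤ 2 * t + 4) M≡ 3n≤)))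
                         (Count.total C C-eq)
        where
        open ≤-Reasoning
        3n≤ : 3 * n ≤ 2 * M + 4
        3n≤ = begin
          3 * n                            ≡⟨ cong (λ t → t + 2 * n) n≡2k+b ⟩
          2 * k + b + 2 * n                ≤⟨ m≤m+n _ b ⟩
          2 * k + b + 2 * n + b            ≡⟨ move k b n ⟩
          2 * (k + b + n)                  ≤⟨ *-monoʳ-≤ 2 (≤-trans (+-monoˡ-≤ n k+b≤m) m+n≤) ⟩
          2 * (M + 2)                      ≡⟨ *-distribˡ-+ 2 M 2 ⟩
          2 * M + 4                        ∎
          where
          move : ∀ k b n → 2 * k + b + 2 * n + b ≡ 2 * (k + b + n)
          move = solve-∀

    -- Large degree sums: the graph is a star

    Off : V r → V r → V r → Set
    Off c a a′ = c ≢ a × c ≢ a′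

    module Dense (τ : ℕ) (m+n≡ : m + n ≡ M + τ) (3≤τ : 3 ≤ τ) where

      degree-sum : ∀ {x u} → Edge x u → τ ≤ deg x + deg (x ⊕ u)
      degree-sum {x} {u} e = +-cancelˡ-≤ M _ _ (subst (_≤ M + (deg x + deg (x ⊕ u))) m+n≡ (degree-bound e))

      k≤2 : ∀ R → Matching R → Maximal R → ∑ (χ R) ≤ 2
      k≤2 R mt mx = matching-size≤2 M n m k b D τ n≡2k+b k+b≤m D+b≤2m (kτ≤D τ degree-sum) m+n≡ 3≤τ large
        where open MaximalMatching R mt mx

      empty-matching : Matching (λ _ → false)
      empty-matching = (λ ()) , (λ {a} _ → ≤-trans (≤-reflexive (∑-0 r)) z≤n)

      5≤τ : 5 ≤ τ
      5≤τ with extend-to-maximal (λ _ → false) empty-matching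
      ... | R , mt , mx , _ = large-degrees M n m k b τ n≡2k+b k+b≤m m+n≡ (k≤2 R mt mx) large
        where open MaximalMatching R mt mx

      -- Their sums form a matching of size 3, and a maximal extension of it would contradict `k≤2`.
      no-three-disjoint-edges : ∀ {a a′ b b′ c c′} → Adj a a′ → Adj b b′ → Adj c c′ →
        Off b a a′ → Off b′ a a′ → Off c a a′ → Off c′ a a′ → Off c b b′ → Off c′ b b′ → ⊥
      no-three-disjoint-edges {a} {a′} {b} {b′} {c} {c′} ea eb ec b-a b′-a c-a c′-a c-b c′-b =
        <⇒≱ (≤-trans (≤-reflexive (sym size)) (proj₂ (proj₂ (proj₂ maximal))))
            (k≤2 (proj₁ maximal) (proj₁ (proj₂ maximal)) (proj₁ (proj₂ (proj₂ maximal))))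
        where
        end : ∀ x y → x ⊕ (x ⊕ y) ≡ y
        end x y = xor-solve (x ∷ y ∷ []) (x₀ ⊞ (x₀ ⊞ x₁)) x₁ refl
        R₀ R₁ R₂ R₃ : Subset₂ r
        R₀ = λ _ → false
        R₁ = insert (a ⊕ a′) R₀
        R₂ = insert (b ⊕ b′) R₁
        R₃ = insert (c ⊕ c′) R₂
        free₀ : ∀ x → tdeg R₀ x ≡ 0
        free₀ x = ∑-0 r
        free-pair : ∀ {R x y} → tdeg R x ≡ 0 → tdeg R y ≡ 0 → tdeg R x + tdeg R (x ⊕ (x ⊕ y)) ≡ 0
        free-pair {R} {x} {y} p q = cong₂ _+_ p (trans (cong (tdeg R) (end x y)) q)
        f₁ = free-pair {R₀} {a} {a′} (free₀ a) (free₀ a′)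
        m₁ = insert-matching empty-matching (adj⇒edge ea) f₁
        free₁ : ∀ {x} → A x ≡ true → Off x a a′ → tdeg R₁ x ≡ 0
        free₁ {x} p (q , q′) = trans (tdeg-insert R₀ refl x) (cong₂ _+_ (free₀ x) (not-end ea p q q′))
        f₂ = free-pair {R₁} (free₁ (proj₁ eb) b-a) (free₁ (proj₁ (proj₂ eb)) b′-a)
        m₂ = insert-matching m₁ (adj⇒edge eb) f₂
        free₂ : ∀ {x} → A x ≡ true → Off x a a′ → Off x b b′ → tdeg R₂ x ≡ 0
        free₂ {x} p q (t , t′) = trans (tdeg-insert R₁ (free-new m₁ (adj⇒edge eb) f₂) x)
          (cong₂ _+_ (free₁ p q) (not-end eb p t t′))
        f₃ = free-pair {R₂} (free₂ (proj₁ ec) c-a c-b) (free₂ (proj₁ (proj₂ ec)) c′-a c′-b)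
        m₃ = insert-matching m₂ (adj⇒edge ec) f₃
        size : ∑ (χ R₃) ≡ 3
        size = trans (∑-insert m₂ (adj⇒edge ec) f₃) (cong suc (trans (∑-insert m₁ (adj⇒edge eb) f₂)
                 (cong suc (trans (∑-insert empty-matching (adj⇒edge ea) f₁) (cong suc (∑-0 r))))))
        maximal = extend-to-maximal R₃ m₃

      high-end : ∀ {x y} → Adj x y → 3 ≤ deg x ⊎ 3 ≤ deg y
      high-end {x} {y} e with 3 ≤? deg x | 3 ≤? deg y
      ... | yes p | _     = inj₁ p
      ... | no _  | yes q = inj₂ q
      ... | no p  | no q  = ⊥-elim (<⇒≱ (≤-trans 5≤τ (subst (λ t → τ ≤ deg x + deg t)
              (xor-solve (x ∷ y ∷ []) (x₀ ⊞ (x₀ ⊞ x₁)) x₁ refl) (degree-sum (adj⇒edge e))))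
              (+-mono-≤ (≤-pred (≰⇒> p)) (≤-pred (≰⇒> q))))

      module TwoHigh {x y} (px : A x ≡ true) (py : A y ≡ true) (x≢y : x ≢ y) (dx : 3 ≤ deg x) (dy : 3 ≤ deg y) where

        -- Neighbours `a` of `x` and `b` of `y` off the edge would complete three disjoint edges. If
        -- `x` and `y` are adjacent, `a` and `b` differ since there is no triangle; if not, `b` is
        -- chosen off `a`, and it cannot be `x`.
        meets : ∀ {p q} → Adj p q → p ≢ x → p ≢ y → q ≢ x → q ≢ y → ⊥
        meets {p} {q} e p≢x p≢y q≢x q≢y with U (x ⊕ y) in xy
        ... | true with neighbour-avoiding-edge px dx e y | neighbour-avoiding-edge py dy e x
        ... | a , xa , a≢p , a≢q , a≢y | b , yb , b≢p , b≢q , b≢x = no-three-disjoint-edges xa yb e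
              ((λ t → x≢y (sym t)) , (λ t → a≢y (sym t)))
              (b≢x , λ { refl → triangle-free (px , py , xy) yb (proj₂ (proj₂ xa)) })
              (p≢x , λ t → a≢p (sym t)) (q≢x , λ t → a≢q (sym t))
              (p≢y , λ t → b≢p (sym t)) (q≢y , λ t → b≢q (sym t))
        meets {p} {q} e p≢x p≢y q≢x q≢y | false with neighbour-avoiding-edge px dx e y
        ... | a , xa , a≢p , a≢q , a≢y with neighbour-avoiding-edge py dy e a
        ... | b , yb , b≢p , b≢q , b≢a = no-three-disjoint-edges xa yb e
              ((λ t → x≢y (sym t)) , (λ t → a≢y (sym t)))
              ((λ { refl → true≢false (trans (sym (proj₂ (proj₂ (adj-sym yb)))) xy) }) , b≢a)
              (p≢x , λ t → a≢p (sym t)) (q≢x , λ t → a≢q (sym t))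
              (p≢y , λ t → b≢p (sym t)) (q≢y , λ t → b≢q (sym t))

        cover : ∀ {a} → A a ≡ true → a ≢ x → a ≢ y → Adj x a ⊎ Adj y a
        cover {a} pa a≢x a≢y with covered pa
        ... | u , e with (a ⊕ u) ≟ⱽ x | (a ⊕ u) ≟ⱽ y
        ... | yes t | _     = inj₁ (adj-sym (subst (Adj a) t (edge⇒adj e)))
        ... | no _  | yes t = inj₂ (adj-sym (subst (Adj a) t (edge⇒adj e)))
        ... | no t  | no t′ = ⊥-elim (meets (edge⇒adj e) a≢x a≢y t t′)

      two-high-impossible : ∀ {x y} → A x ≡ true → A y ≡ true → x ≢ y → 3 ≤ deg x → 3 ≤ deg y → ⊥
      -- `TwoCentres` wants the second star to be the larger one, so the centres are ordered first.
      two-high-impossible {x} {y} px py x≢y dx dy = go (≤-total (∑ (χ (N x ∖ y))) (∑ (χ (N y ∖ x))))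
        where
        ordered : ∀ {x y} → A x ≡ true → A y ≡ true → x ≢ y → 3 ≤ deg x → 3 ≤ deg y →
                  ∑ (χ (N x ∖ y)) ≤ ∑ (χ (N y ∖ x)) → ⊥
        ordered {x} {y} px py x≢y dx dy le =
          let (e₁ , adj , e₁≢y , _) = neighbour-avoiding₂ px dx y y
          in TwoCentres.impossible px py x≢y (TwoHigh.cover px py x≢y dx dy) adj e₁≢y le
        go : ∑ (χ (N x ∖ y)) ≤ ∑ (χ (N y ∖ x)) ⊎ ∑ (χ (N y ∖ x)) ≤ ∑ (χ (N x ∖ y)) → ⊥
        go (inj₁ le) = ordered px py x≢y dx dy le
        go (inj₂ le) = ordered py px (λ t → x≢y (sym t)) dy dx le

      -- Otherwise an edge at `a` misses `x`, yet it has an end of degree at least 3: a second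
      -- vertex of high degree.
      universal : ∀ {x} → A x ≡ true → 3 ≤ deg x → ∀ {a} → A a ≡ true → a ≢ x → Adj x a
      universal {x} px dx {a} pa a≢x = go (true-or-false (U (x ⊕ a)))
        where
        go : U (x ⊕ a) ≡ true ⊎ U (x ⊕ a) ≡ false → Adj x a
        go (inj₁ s) = px , pa , s
        go (inj₂ s) = ⊥-elim (conflict (high-end a~w))
          where
          u = proj₁ (covered pa)
          a~w : Adj a (a ⊕ u)
          a~w = edge⇒adj (proj₂ (covered pa))
          x≢w : x ≢ a ⊕ u
          x≢w t = true≢false (trans (sym (trans (cong (λ v → U (v ⊕ a)) t) (proj₂ (proj₂ (adj-sym a~w))))) s)
          conflict : 3 ≤ deg a ⊎ 3 ≤ deg (a ⊕ u) → ⊥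
          conflict (inj₁ da) = two-high-impossible px pa (λ t → a≢x (sym t)) dx da
          conflict (inj₂ dw) = two-high-impossible px (proj₁ (proj₂ a~w)) x≢w dx dw

      centre : ∃ λ g → A g ≡ true × (∀ {a} → A a ≡ true → a ≢ g → Adj g a)
      centre = pick (high-end a~w)
        where
        inhabited = ∑χ-inhabited A (≤-trans (s≤s z≤n) 3<n)
        a = proj₁ inhabited
        pa : A a ≡ true
        pa = proj₂ inhabited
        u = proj₁ (covered pa)
        a~w : Adj a (a ⊕ u)
        a~w = edge⇒adj (proj₂ (covered pa))
        pick : 3 ≤ deg a ⊎ 3 ≤ deg (a ⊕ u) → ∃ λ g → A g ≡ true × (∀ {a} → A a ≡ true → a ≢ g → Adj g a)
        pick (inj₁ d) = a , pa , universal pa d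
        pick (inj₂ d) = a ⊕ u , proj₁ (proj₂ a~w) , universal (proj₁ (proj₂ a~w)) d

    star-centre : (∃ λ j → M ≡ 2 ^ j) → ∃ λ g → A g ≡ true × (∀ {a} → A a ≡ true → a ≢ g → Adj g a)
    star-centre M-power with m + n ≤? M + 2
    ... | yes le = ⊥-elim (contradiction le)
      where
      contradiction : m + n ≤ M + 2 → ⊥
      contradiction with extend-to-maximal (λ _ → false) ((λ ()) , (λ {a} _ → ≤-trans (≤-reflexive (∑-0 r)) z≤n))
      ... | R , mt , mx , _ = MaximalMatching.sparse R mt mx M-power
    ... | no gt with m≤n⇒∃[o]m+o≡n (≰⇒> gt)
    ... | d , eq = Dense.centre (3 + d) (trans (sym eq) (shift M d)) (m≤m+n 3 d)
      where
      shift : ∀ M d → suc (M + 2) + d ≡ M + (3 + d)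
      shift = solve-∀

theorem3p3 : (r : ℕ) → 1 ≤ r → (A : Subset₂ r) → Round A
    → 11 * 2 ^ r + 108 < 36 * card A
    → ∃ λ (S : Subset₂ r) → ∃ λ (g : V r) → SumFree S × IsTranslateOfSZero A g S
theorem3p3 (suc j) _ A round large = star⇒translate pg star
  where
  half : 11 * 2 ^ j + 54 < 18 * ∑ (χ A)
  half = *-cancelˡ-< 2 _ _ (subst₂ _<_ (id₁ (2 ^ j)) (trans (cong (36 *_) (card≡∑ A)) (id₂ (∑ (χ A)))) large)
    where
    id₁ : ∀ t → 11 * (2 * t) + 108 ≡ 2 * (11 * t + 54)
    id₁ = solve-∀
    id₂ : ∀ t → 36 * t ≡ 2 * (18 * t)
    id₂ = solve-∀
  open Graph A (2 ^ j) refl half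
  centre = Covered.star-centre (round⇒covered round) (j , refl)
  pg = proj₁ (proj₂ centre)
  star = proj₂ (proj₂ centre)
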